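{- Suppose that every $PG(3,2)$-free matroid $M'$ with $|M'|>(1-3\cdot 2^{ -4})2^{r(M')}$ satisfies $\chi(M')\in\{3,4\}$. Then there is no $PG(4,2)$-free matroid $M$ with $|M|>(1-3\cdot 2^{ -5})2^{r(M)}$ and $\chi(M)>5$.
   Context: A matroid $M$ means a simple binary matroid, represented by an integer $r(M)\geq 0$ (its rank) and a set $E(M)\subseteq \mathbb{F}_2^{r(M)}\setminus\{0\}$ that spans $\mathbb{F}_2^{r(M)}$; $|M|:=|E(M)|$. The critical number $\chi(M)$ is the smallest $k$ such that some subspace of $\mathbb{F}_2^{r(M)}$ of codimension $k$ is disjoint from $E(M)$. A matroid $M$ contains a matroid $N$ if there is an injective linear map $\iota:\mathbb{F}_2^{r(N)}\to\mathbb{F}_2^{r(M)}$ with $\iota(E(N))\subseteq E(M)$; $M$ is $N$-free if it does not contain $N$. The projective geometry $PG(s-1,2)$ is the matroid of rank $s$ with edge set $\mathbb{F}_2^s\setminus\{0\}$. -}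

module Defs where

open import Data.Bool using (Bool; true; false; not; _xor_; if_then_else_)
open import Data.Nat using (ℕ; zero; suc; _+_; _*_; _^_; _<_; _≤_; _∸_)
open import Data.Vec using (Vec; []; _∷_; zipWith; replicate)
open import Data.List using (List; []; _∷_; foldr; filter; length; map; _++_)
open import Data.List.Relation.Unary.All using (All; []; _∷_)
open import Data.Product using (Σ; ∃; _×_; _,_)
open import Data.Sum using (_⊎_)
open import Relation.Nullary using (¬_)
open import Relation.Binary.PropositionalEquality using (_≡_; refl; cong)

-- vectors of 𝔽₂^r, with 𝔽₂ = Bool (xor is addition, ∧ multiplication)
V : ℕ → Set
V r = Vec Bool r

0v : ∀ {r} → V r
0v = replicate _ false

_⊕_ : ∀ {r} → V r → V r → V r
_⊕_ = zipWith _xor_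

Σv : ∀ {r} → List (V r) → V r
Σv = foldr _⊕_ 0v

isZero : ∀ {r} → V r → Bool
isZero [] = true
isZero (true ∷ v) = false
isZero (false ∷ v) = isZero v

allV : (r : ℕ) → List (V r)
allV zero = [] ∷ []
allV (suc r) = map (false ∷_) (allV r) ++ map (true ∷_) (allV r)

-- a simple binary matroid: rank r, edge set E ⊆ 𝔽₂^r ∖ {0} (as decidable predicate) spanning 𝔽₂^r
record Matroid : Set where
  field
    rank     : ℕ
    E        : V rank → Bool
    no-zero  : E 0v ≡ false
    spanning : ∀ (v : V rank) → Σ (List (V rank)) λ xs → All (λ x → E x ≡ true) xs × Σv xs ≡ v
open Matroid public

size : Matroid → ℕ
size M = length (filter (λ v → E M v Data.Bool.≟ true) (allV (rank M)))
  where import Data.Bool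

-- linear maps 𝔽₂^s → 𝔽₂^r, given by the images of the standard basis vectors (columns)
Lin : ℕ → ℕ → Set
Lin s r = Vec (V r) s

apply : ∀ {s r} → Lin s r → V s → V r
apply [] [] = 0v
apply (c ∷ cs) (b ∷ v) = (if b then c else 0v) ⊕ apply cs v

Injective : ∀ {s r} → Lin s r → Set
Injective A = ∀ u v → apply A u ≡ apply A v → u ≡ v

Contains : Matroid → Matroid → Set
Contains M N = Σ (Lin (rank N) (rank M)) λ ι →
  Injective ι × (∀ v → E N v ≡ true → E M (apply ι v) ≡ true)

_-free : Matroid → Matroid → Set
(N -free) M = ¬ Contains M N

private
  ⊕-0v : ∀ {r} (v : V r) → v ⊕ 0v ≡ v
  ⊕-0v [] = refl
  ⊕-0v (false ∷ v) = cong (false ∷_) (⊕-0v v)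
  ⊕-0v (true ∷ v) = cong (true ∷_) (⊕-0v v)

  isZero-0v : ∀ r → isZero (0v {r}) ≡ true
  isZero-0v zero = refl
  isZero-0v (suc r) = isZero-0v r

  isZero⇒0v : ∀ {r} (v : V r) → isZero v ≡ true → v ≡ 0v
  isZero⇒0v [] _ = refl
  isZero⇒0v (false ∷ v) p = cong (false ∷_) (isZero⇒0v v p)
  isZero⇒0v (true ∷ v) ()

  pg-span : ∀ {s} (v : V s) (b : Bool) → isZero v ≡ b →
    Σ (List (V s)) λ xs → All (λ x → not (isZero x) ≡ true) xs × Σv xs ≡ v
  pg-span v true p = [] , [] , Relation.Binary.PropositionalEquality.sym (isZero⇒0v v p)
    where import Relation.Binary.PropositionalEquality
  pg-span v false p = v ∷ [] , (cong not p ∷ []) , ⊕-0v v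

  pg-nz : ∀ s → not (isZero (0v {s})) ≡ false
  pg-nz s = cong not (isZero-0v s)

PG[_-1,2] : ℕ → Matroid
PG[ s -1,2] = record
  { rank = s
  ; E = λ v → not (isZero v)
  ; no-zero = pg-nz s
  ; spanning = λ v → pg-span v (isZero v) refl
  }

-- some subspace of codimension k is disjoint from E(M):
-- a subspace of codimension k is the image of an injective linear map 𝔽₂^(r-k) → 𝔽₂^r (k ≤ r)
CodimDisjoint : Matroid → ℕ → Set
CodimDisjoint M k = k ≤ rank M × Σ (Lin (rank M ∸ k) (rank M)) λ A →
  Injective A × (∀ v → E M (apply A v) ≡ false)

χ≡ : Matroid → ℕ → Set
χ≡ M k = CodimDisjoint M k × (∀ j → j < k → ¬ CodimDisjoint M j)

{-# OPTIONS --safe #-}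
module Submission where

{-
Let M have rank n = p + 5, put u = 2^p and let B be the complement of E(M), so that |B| < 3u. Suppose
that B contains no subspace of codimension 5. The hypothesis, applied to B ∩ H for a hyperplane H,
yields a 4-dimensional T ⊆ H with T ∩ B = 0. As M is PG(4,2)-free, B meets every coset of T outside H,
whence |B ∖ H| ≥ u. Applied to B ∩ K for K of codimension 2, as a subset of a hyperplane containing K,
the hypothesis yields a 3-dimensional T ⊆ K with T ∩ B = 0.

Projecting B from a point e ∈ E(M) gives a subspace W ∋ e of codimension 4 in which B meets every coset
of {0, e}; hence |B ∩ W| ≥ u and |B ∖ W| < 2u. Five subspaces of codimension 2, forming a spread of
the quotient by W, cover everything and pairwise meet in W, so one of them, K, has |B ∖ K| < 8u/5.

For T ⊆ K of dimension 3 as above, let S be the union of the cosets of T that miss B. It is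
triangle-free, since otherwise T extends to a PG(4,2) in M, and |S ∖ K| > 7|K|/5. Such an S misses a
hyperplane H. Then B meets every coset of T in H, so |B ∩ H| ≥ 2u and |B| ≥ 3u, a contradiction.

To see that S misses a hyperplane, let X₁, X₂, X₃ be its parts in the cosets of K other than K. If all
are nonempty, then |Xᵢ| + |Xⱼ| ≤ |K| and so |Xᵢ| > 2|K|/5. Hence |Xᵢ + Xⱼ| < 3|Xᵢ|/2, which
forces all the sets Xᵢ + Xᵢ to be one and the same subgroup of index 2 in K.
-}

open import Defs
open import Data.Bool using (Bool; true; false; not; _xor_; _∧_; _∨_; if_then_else_)
import Data.Bool.Properties as 𝔹
open import Data.Empty using (⊥; ⊥-elim)
open import Data.Fin using (Fin; zero; suc)
open import Data.List using (List; []; _∷_; length; filter; map; _++_)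
import Data.List.Properties as List
open import Data.List.Relation.Unary.All as All using (All; []; _∷_)
open import Data.Nat
  using (ℕ; zero; suc; _+_; _*_; _^_; _≤_; _<_; z≤n; s≤s)
open import Data.Nat.ListAction using (sum)
import Data.Nat.Properties as ℕ
open import Data.Nat.Tactic.RingSolver using (solve-∀)
open import Data.Product using (Σ; ∃; _×_; _,_; proj₁; proj₂)
open import Data.Sum using (_⊎_; inj₁; inj₂; [_,_]′)
open import Data.Vec using ([]; _∷_; lookup; head; replicate) renaming (_++_ to _++ᵛ_)
open import Data.Vec.Properties using (≡-dec; ∷-injective; ∷-injectiveʳ)
open import Function using (_∘_; case_of_)
open import Relation.Nullary using (¬_; Dec; yes; no; ⌊_⌋)
open import Relation.Binary.PropositionalEquality
  using (_≡_; _≢_; refl; sym; trans; cong; cong₂; subst; subst₂; module ≡-Reasoning)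

-- Vectors over 𝔽₂

⊕-assoc : ∀ {n} (u v w : V n) → (u ⊕ v) ⊕ w ≡ u ⊕ (v ⊕ w)
⊕-assoc [] [] [] = refl
⊕-assoc (a ∷ u) (b ∷ v) (c ∷ w) = cong₂ _∷_ (𝔹.xor-assoc a b c) (⊕-assoc u v w)

⊕-comm : ∀ {n} (u v : V n) → u ⊕ v ≡ v ⊕ u
⊕-comm [] [] = refl
⊕-comm (a ∷ u) (b ∷ v) = cong₂ _∷_ (𝔹.xor-comm a b) (⊕-comm u v)

⊕-identityˡ : ∀ {n} (v : V n) → 0v ⊕ v ≡ v
⊕-identityˡ [] = refl
⊕-identityˡ (_ ∷ v) = cong (_ ∷_) (⊕-identityˡ v)

⊕-identityʳ : ∀ {n} (v : V n) → v ⊕ 0v ≡ v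
⊕-identityʳ v = trans (⊕-comm v 0v) (⊕-identityˡ v)

⊕-self : ∀ {n} (v : V n) → v ⊕ v ≡ 0v
⊕-self [] = refl
⊕-self (a ∷ v) = cong₂ _∷_ (𝔹.xor-same a) (⊕-self v)

⊕-interchange : ∀ {n} (a b c d : V n) → (a ⊕ b) ⊕ (c ⊕ d) ≡ (a ⊕ c) ⊕ (b ⊕ d)
⊕-interchange a b c d = begin
  (a ⊕ b) ⊕ (c ⊕ d)  ≡⟨ ⊕-assoc a b _ ⟩
  a ⊕ (b ⊕ (c ⊕ d))  ≡⟨ cong (a ⊕_) (⊕-assoc b c d) ⟨
  a ⊕ ((b ⊕ c) ⊕ d)  ≡⟨ cong (λ z → a ⊕ (z ⊕ d)) (⊕-comm b c) ⟩
  a ⊕ ((c ⊕ b) ⊕ d)  ≡⟨ cong (a ⊕_) (⊕-assoc c b d) ⟩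
  a ⊕ (c ⊕ (b ⊕ d))  ≡⟨ ⊕-assoc a c _ ⟨
  (a ⊕ c) ⊕ (b ⊕ d)  ∎
  where open ≡-Reasoning

isZero-sound : ∀ {n} (v : V n) → isZero v ≡ true → v ≡ 0v
isZero-sound [] _ = refl
isZero-sound (false ∷ v) p = cong (false ∷_) (isZero-sound v p)

isZero-0v : ∀ n → isZero (0v {n}) ≡ true
isZero-0v zero = refl
isZero-0v (suc n) = isZero-0v n

false≢true : ∀ {b} → b ≡ false → b ≢ true
false≢true refl ()

-- Linear maps as additive functions

record _⊸_ (s r : ℕ) : Set where
  constructor hom
  field
    _$_      : V s → V r
    additive : ∀ u v → _$_ (u ⊕ v) ≡ _$_ u ⊕ _$_ v
  infixr 5 _$_
open _⊸_

private variable
  k m n r s : ℕ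

scale : Bool → V r → V r
scale b c = if b then c else 0v

scale-xor : ∀ a b (c : V r) → scale (a xor b) c ≡ scale a c ⊕ scale b c
scale-xor false b c = sym (⊕-identityˡ _)
scale-xor true false c = sym (⊕-identityʳ c)
scale-xor true true c = sym (⊕-self c)

apply-⊕ : (A : Lin s r) (u v : V s) → apply A (u ⊕ v) ≡ apply A u ⊕ apply A v
apply-⊕ [] [] [] = sym (⊕-self 0v)
apply-⊕ (c ∷ A) (a ∷ u) (b ∷ v) =
  trans (cong₂ _⊕_ (scale-xor a b c) (apply-⊕ A u v)) (⊕-interchange (scale a c) _ _ _)

⟦_⟧ : Lin s r → s ⊸ r
⟦ A ⟧ = hom (apply A) (apply-⊕ A)

_⊚_ : s ⊸ r → k ⊸ s → k ⊸ r
(f ⊚ g) $ v = f $ g $ v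
(f ⊚ g) .additive u v = trans (cong (f $_) (g .additive u v)) (f .additive _ _)

cons : V r → s ⊸ r → suc s ⊸ r
cons c f $ (b ∷ v) = scale b c ⊕ (f $ v)
cons c f .additive (a ∷ u) (b ∷ v) =
  trans (cong₂ _⊕_ (scale-xor a b c) (f .additive u v)) (⊕-interchange (scale a c) _ _ _)

0∷ : n ⊸ suc n
0∷ = hom (false ∷_) (λ _ _ → refl)

$-0v : (f : s ⊸ r) → (f $ 0v) ≡ 0v
$-0v f = begin
  f $ 0v                          ≡⟨ ⊕-identityʳ _ ⟨
  (f $ 0v) ⊕ 0v                   ≡⟨ cong ((f $ 0v) ⊕_) (⊕-self (f $ 0v)) ⟨
  (f $ 0v) ⊕ ((f $ 0v) ⊕ (f $ 0v))  ≡⟨ cong ((f $ 0v) ⊕_) (f .additive 0v 0v) ⟨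
  (f $ 0v) ⊕ (f $ (0v ⊕ 0v))      ≡⟨ cong (λ z → (f $ 0v) ⊕ (f $ z)) (⊕-self 0v) ⟩
  (f $ 0v) ⊕ (f $ 0v)             ≡⟨ ⊕-self _ ⟩
  0v                              ∎
  where open ≡-Reasoning

$-∷ : (f : suc s ⊸ r) (b : Bool) (v : V s) →
  (f $ (b ∷ v)) ≡ scale b (f $ (true ∷ 0v)) ⊕ (f $ (false ∷ v))
$-∷ f false v = sym (⊕-identityˡ _)
$-∷ f true v =
  trans (cong (λ z → f $ (true ∷ z)) (sym (⊕-identityˡ v))) (f .additive (true ∷ 0v) (false ∷ v))

matrix : s ⊸ r → Lin s r
matrix {zero} f = []
matrix {suc s} f = (f $ (true ∷ 0v)) ∷ matrix (f ⊚ 0∷)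

apply-matrix : (f : s ⊸ r) (v : V s) → apply (matrix f) v ≡ (f $ v)
apply-matrix f [] = sym ($-0v f)
apply-matrix f (b ∷ v) =
  trans (cong (scale b _ ⊕_) (apply-matrix (f ⊚ 0∷) v)) (sym ($-∷ f b v))

Inj : s ⊸ r → Set
Inj f = ∀ u v → (f $ u) ≡ (f $ v) → u ≡ v

Onto : s ⊸ r → Set
Onto f = ∀ c → ∃ λ v → (f $ v) ≡ c

⊕≡0v⇒≡ : (u v : V n) → u ⊕ v ≡ 0v → u ≡ v
⊕≡0v⇒≡ u v p = begin
  u            ≡⟨ ⊕-identityʳ u ⟨
  u ⊕ 0v       ≡⟨ cong (u ⊕_) (⊕-self v) ⟨
  u ⊕ (v ⊕ v)  ≡⟨ ⊕-assoc u v v ⟨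
  (u ⊕ v) ⊕ v  ≡⟨ cong (_⊕ v) p ⟩
  0v ⊕ v       ≡⟨ ⊕-identityˡ v ⟩
  v            ∎
  where open ≡-Reasoning

trivial-kernel⇒Inj : (f : s ⊸ r) → (∀ v → (f $ v) ≡ 0v → v ≡ 0v) → Inj f
trivial-kernel⇒Inj f ker u v p =
  ⊕≡0v⇒≡ u v (ker _ (trans (f .additive u v) (trans (cong (_⊕ (f $ v)) p) (⊕-self _))))

-- Identities between sums of vectors are decided by comparing the parities of the variables.

data Expr (k : ℕ) : Set where
  ε   : Expr k
  var : Fin k → Expr k
  _⊞_ : Expr k → Expr k → Expr k

infixl 6 _⊞_

parity : Expr k → V k
parity ε = 0v
parity (var zero) = true ∷ 0v
parity (var (suc i)) = false ∷ parity (var i)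
parity (a ⊞ b) = parity a ⊕ parity b

eval : Lin k n → Expr k → V n
eval ρ ε = 0v
eval ρ (var i) = lookup ρ i
eval ρ (a ⊞ b) = eval ρ a ⊕ eval ρ b

eval-parity : (ρ : Lin k n) (a : Expr k) → eval ρ a ≡ apply ρ (parity a)
eval-parity ρ ε = sym ($-0v ⟦ ρ ⟧)
eval-parity (x ∷ ρ) (var zero) =
  sym (trans (cong (x ⊕_) ($-0v ⟦ ρ ⟧)) (⊕-identityʳ x))
eval-parity (x ∷ ρ) (var (suc i)) = trans (eval-parity ρ (var i)) (sym (⊕-identityˡ _))
eval-parity ρ (a ⊞ b) =
  trans (cong₂ _⊕_ (eval-parity ρ a) (eval-parity ρ b)) (sym (apply-⊕ ρ (parity a) (parity b)))

⊕-solve : (ρ : Lin k n) (a b : Expr k) → parity a ≡ parity b → eval ρ a ≡ eval ρ b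
⊕-solve ρ a b p = trans (eval-parity ρ a) (trans (cong (apply ρ) p) (sym (eval-parity ρ b)))

pattern x₀ = var zero
pattern x₁ = var (suc zero)
pattern x₂ = var (suc (suc zero))
pattern x₃ = var (suc (suc (suc zero)))
pattern x₄ = var (suc (suc (suc (suc zero))))

⊕-cancelʳ : (u v : V n) → (u ⊕ v) ⊕ v ≡ u
⊕-cancelʳ u v = ⊕-solve (u ∷ v ∷ []) (x₀ ⊞ x₁ ⊞ x₁) x₀ refl

⊕-cancelˡ : (u v : V n) → u ⊕ (u ⊕ v) ≡ v
⊕-cancelˡ u v = ⊕-solve (u ∷ v ∷ []) (x₀ ⊞ (x₀ ⊞ x₁)) x₁ refl

-- Kernels, quotients and functionals

-- `ψ` may vanish, and then `ι` parametrises only a hyperplane of its kernel. This allows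
-- restricting a functional to a subspace without asking whether it becomes zero.
record Into-kernel (ψ : suc n ⊸ 1) : Set where
  field
    ι     : n ⊸ suc n
    ι-inj : Inj ι
    ψι≡0  : ∀ v → (ψ $ ι $ v) ≡ 0v

-- If `ψ` is 1 on the first basis vector, its kernel is the graph of `ψ` on the remaining
-- coordinates. Otherwise that vector lies in the kernel and the recursion treats the rest.
into-kernel : (ψ : suc n ⊸ 1) → Into-kernel ψ
into-kernel {n} ψ with ψ $ (true ∷ 0v) in eq
... | true ∷ [] = record
  { ι = hom graph (λ u v → cong (_∷ (u ⊕ v)) (graph-⊕ u v))
  ; ι-inj = λ u v p → ∷-injectiveʳ p
  ; ψι≡0 = λ v → in-kernel v (ψ $ (false ∷ v)) refl
  }
  where
  bit : V 1 → Bool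
  bit (b ∷ []) = b
  graph : V n → V (suc n)
  graph v = bit (ψ $ (false ∷ v)) ∷ v
  bit-⊕ : (u v : V 1) → bit (u ⊕ v) ≡ bit u xor bit v
  bit-⊕ (_ ∷ []) (_ ∷ []) = refl
  graph-⊕ : ∀ u v → bit (ψ $ (false ∷ (u ⊕ v))) ≡ bit (ψ $ (false ∷ u)) xor bit (ψ $ (false ∷ v))
  graph-⊕ u v = trans (cong bit (ψ .additive (false ∷ u) (false ∷ v))) (bit-⊕ (ψ $ (false ∷ u)) _)
  in-kernel : ∀ v c → (ψ $ (false ∷ v)) ≡ c → (ψ $ (bit c ∷ v)) ≡ 0v
  in-kernel v (false ∷ []) p = p
  in-kernel v (true ∷ []) p = trans ($-∷ ψ true v) (cong₂ _⊕_ eq p)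
into-kernel {zero} ψ | false ∷ [] = record
  { ι = hom (λ _ → 0v) (λ _ _ → refl) ; ι-inj = λ { [] [] _ → refl } ; ψι≡0 = λ _ → $-0v ψ }
into-kernel {suc n} ψ | false ∷ [] = record
  { ι = hom ι′ ι′-⊕ ; ι-inj = ι′-inj ; ψι≡0 = ψι′ }
  where
  open Into-kernel (into-kernel (ψ ⊚ 0∷))
  ι′ : V (suc n) → V (suc (suc n))
  ι′ (b ∷ v) = b ∷ (ι $ v)
  ι′-⊕ : ∀ u v → ι′ (u ⊕ v) ≡ ι′ u ⊕ ι′ v
  ι′-⊕ (a ∷ u) (b ∷ v) = cong (_ ∷_) (ι .additive u v)
  ι′-inj : ∀ u v → ι′ u ≡ ι′ v → u ≡ v
  ι′-inj (a ∷ u) (b ∷ v) p = cong₂ _∷_ (proj₁ (∷-injective p)) (ι-inj u v (proj₂ (∷-injective p)))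
  ψι′ : ∀ v → (ψ $ ι′ v) ≡ 0v
  ψι′ (false ∷ v) = ψι≡0 v
  ψι′ (true ∷ v) = trans ($-∷ ψ true (ι $ v)) (cong₂ _⊕_ eq (ψι≡0 v))

-- The first coordinate where `c` is 1 is eliminated by adding `c`; if `c` is zero, the last
-- coordinate is dropped. Exactly one dimension is lost either way.
quotient-by : (c : V (suc n)) → Σ (suc n ⊸ n) λ h → Onto h × (h $ c) ≡ 0v
quotient-by (true ∷ c) = cons c (hom (λ v → v) (λ _ _ → refl)) ,
  (λ v → (false ∷ v) , ⊕-identityˡ v) , ⊕-self c
quotient-by {zero} (false ∷ []) = hom (λ _ → []) (λ _ _ → refl) , (λ { [] → (0v , refl) }) , refl
quotient-by {suc n} (false ∷ c) with quotient-by c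
... | h , onto , hc = hom h′ h′-⊕ , onto′ , cong (false ∷_) hc
  where
  h′ : V (suc (suc n)) → V (suc n)
  h′ (b ∷ v) = b ∷ (h $ v)
  h′-⊕ : ∀ u v → h′ (u ⊕ v) ≡ h′ u ⊕ h′ v
  h′-⊕ (a ∷ u) (b ∷ v) = cong (_ ∷_) (h .additive u v)
  onto′ : ∀ v → ∃ λ w → h′ w ≡ v
  onto′ (b ∷ v) = (b ∷ proj₁ (onto v)) , cong (b ∷_) (proj₂ (onto v))

-- The image of one basis vector is divided out at a time, each time at the cost of exactly one
-- dimension.
annihilator : ∀ s k → s + k ≡ n → (f : s ⊸ n) → Σ (n ⊸ k) λ g → Onto g × (∀ v → (g $ f $ v) ≡ 0v)
annihilator zero k refl f = hom (λ v → v) (λ _ _ → refl) , (λ v → v , refl) , (λ { [] → $-0v f })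
annihilator (suc s) k eq f
  with g , g-onto , gf ← annihilator s (suc k) (trans (ℕ.+-suc s k) eq) (f ⊚ 0∷)
  with h , h-onto , hc ← quotient-by (g $ f $ (true ∷ 0v))
  = h ⊚ g , onto , killed
  where
  onto : Onto (h ⊚ g)
  onto c with v , refl ← h-onto c with w , refl ← g-onto v = w , refl
  killed : ∀ v → (h $ g $ f $ v) ≡ 0v
  killed (false ∷ v) = trans (cong (h $_) (gf v)) ($-0v h)
  killed (true ∷ v) = begin
    h $ g $ f $ (true ∷ v)  ≡⟨ cong (λ z → h $ g $ z) ($-∷ f true v) ⟩
    h $ g $ (f $ (true ∷ 0v)) ⊕ (f $ (false ∷ v))  ≡⟨ (h ⊚ g) .additive (f $ (true ∷ 0v)) _ ⟩
    (h $ g $ f $ (true ∷ 0v)) ⊕ (h $ g $ f $ (false ∷ v))  ≡⟨ cong₂ _⊕_ hc (killed (false ∷ v)) ⟩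
    0v ⊕ 0v  ≡⟨ ⊕-self 0v ⟩
    0v  ∎
    where open ≡-Reasoning

separating-functional : (e : V n) → isZero e ≡ false → Σ (n ⊸ 1) λ ψ → (ψ $ e) ≡ (true ∷ [])
separating-functional (true ∷ e) _ = cons (true ∷ []) (hom (λ _ → 0v) (λ _ _ → refl)) , refl
separating-functional (false ∷ e) nz with separating-functional e nz
... | ψ , p = ψ ⊚ hom (λ { (_ ∷ v) → v }) (λ { (_ ∷ _) (_ ∷ _) → refl }) , p

-- Sums and cardinalities over 𝔽₂ⁿ

∑ : (V n → ℕ) → ℕ
∑ {zero} f = f []
∑ {suc n} f = ∑ (f ∘ (false ∷_)) + ∑ (f ∘ (true ∷_))

∑-mono : {f g : V n → ℕ} → (∀ v → f v ≤ g v) → ∑ f ≤ ∑ g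
∑-mono {zero} p = p []
∑-mono {suc n} p = ℕ.+-mono-≤ (∑-mono (p ∘ (false ∷_))) (∑-mono (p ∘ (true ∷_)))

∑-cong : {f g : V n → ℕ} → (∀ v → f v ≡ g v) → ∑ f ≡ ∑ g
∑-cong {zero} p = p []
∑-cong {suc n} p = cong₂ _+_ (∑-cong (p ∘ (false ∷_))) (∑-cong (p ∘ (true ∷_)))

+-interchange : ∀ a b c d → (a + b) + (c + d) ≡ (a + c) + (b + d)
+-interchange = solve-∀

∑-+ : (f g : V n → ℕ) → ∑ (λ v → f v + g v) ≡ ∑ f + ∑ g
∑-+ {zero} f g = refl
∑-+ {suc n} f g =
  trans (cong₂ _+_ (∑-+ (f ∘ (false ∷_)) _) (∑-+ (f ∘ (true ∷_)) _)) (+-interchange (∑ (f ∘ (false ∷_))) _ _ _)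

∑-const : ∀ n c → ∑ {n} (λ _ → c) ≡ 2 ^ n * c
∑-const zero c = sym (ℕ.+-identityʳ c)
∑-const (suc n) c = trans (cong₂ _+_ (∑-const n c) (∑-const n c)) (lemma (2 ^ n) c)
  where
  lemma : ∀ a c → a * c + a * c ≡ 2 * a * c
  lemma = solve-∀

∑-*ˡ : ∀ c (f : V n → ℕ) → ∑ (λ v → c * f v) ≡ c * ∑ f
∑-*ˡ {zero} c f = refl
∑-*ˡ {suc n} c f =
  trans (cong₂ _+_ (∑-*ˡ c (f ∘ (false ∷_))) (∑-*ˡ c (f ∘ (true ∷_)))) (sym (ℕ.*-distribˡ-+ c _ _))

∑-swap : (f : V m → V n → ℕ) → ∑ (λ u → ∑ (f u)) ≡ ∑ (λ v → ∑ (λ u → f u v))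
∑-swap {zero} f = refl
∑-swap {suc m} f =
  trans (cong₂ _+_ (∑-swap (f ∘ (false ∷_))) (∑-swap (f ∘ (true ∷_)))) (sym (∑-+ (λ v → ∑ (λ u → f (false ∷ u) v)) _))

∑-translate : (t : V n) (f : V n → ℕ) → ∑ (λ v → f (v ⊕ t)) ≡ ∑ f
∑-translate [] f = refl
∑-translate (false ∷ t) f = cong₂ _+_ (∑-translate t (f ∘ (false ∷_))) (∑-translate t (f ∘ (true ∷_)))
∑-translate (true ∷ t) f =
  trans (cong₂ _+_ (∑-translate t (f ∘ (true ∷_))) (∑-translate t (f ∘ (false ∷_)))) (ℕ.+-comm (∑ (f ∘ (true ∷_))) _)

term≤∑ : (f : V n → ℕ) (v : V n) → f v ≤ ∑ f
term≤∑ f [] = ℕ.≤-refl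
term≤∑ f (false ∷ v) = ℕ.≤-trans (term≤∑ (f ∘ (false ∷_)) v) (ℕ.m≤m+n _ _)
term≤∑ f (true ∷ v) = ℕ.≤-trans (term≤∑ (f ∘ (true ∷_)) v) (ℕ.m≤n+m _ _)

-- Subsets of 𝔽₂ⁿ and their cardinalities

Subset : ℕ → Set
Subset n = V n → Bool

infix 4 _∈_
_∈_ : V n → Subset n → Set
v ∈ P = P v ≡ true

infixr 7 _∩_
infixr 6 _∪_

_∩_ _∪_ : Subset n → Subset n → Subset n
(P ∩ Q) v = P v ∧ Q v
(P ∪ Q) v = P v ∨ Q v

∁ : Subset n → Subset n
∁ P v = not (P v)

∩-intro : ∀ {a b} → a ≡ true → b ≡ true → a ∧ b ≡ true
∩-intro refl refl = refl

∩-elimˡ : ∀ {a b} → a ∧ b ≡ true → a ≡ true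
∩-elimˡ {true} _ = refl

∩-elimʳ : ∀ {a b} → a ∧ b ≡ true → b ≡ true
∩-elimʳ {true} p = p

∁-intro : ∀ {a} → a ≢ true → not a ≡ true
∁-intro {false} _ = refl
∁-intro {true} p = ⊥-elim (p refl)

∁-elim : ∀ {a} → not a ≡ true → a ≢ true
∁-elim {false} _ ()

⟨_⟩ : Bool → ℕ
⟨ true ⟩ = 1
⟨ false ⟩ = 0

infix 8 #_

#_ : Subset n → ℕ
# P = ∑ (λ v → ⟨ P v ⟩)

⟨⟩-mono : ∀ {a b} → (a ≡ true → b ≡ true) → ⟨ a ⟩ ≤ ⟨ b ⟩
⟨⟩-mono {false} p = z≤n
⟨⟩-mono {true} p rewrite p refl = s≤s z≤n

#-mono : (P Q : Subset n) → (∀ v → v ∈ P → v ∈ Q) → # P ≤ # Q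
#-mono P Q p = ∑-mono (λ v → ⟨⟩-mono (p v))

#-translate : (t : V n) (P : Subset n) → # (λ v → P (v ⊕ t)) ≡ # P
#-translate t P = ∑-translate t (λ v → ⟨ P v ⟩)

#-disjoint : (P Q R : Subset n) → (∀ v → v ∈ P → v ∈ R) → (∀ v → v ∈ Q → v ∈ R) →
  (∀ v → v ∈ P → ¬ v ∈ Q) → # P + # Q ≤ # R
#-disjoint P Q R P⊆R Q⊆R disj =
  subst (_≤ # R) (∑-+ (λ v → ⟨ P v ⟩) _) (∑-mono λ v → pointwise (P⊆R v) (Q⊆R v) (disj v))
  where
  pointwise : ∀ {a b c} → (a ≡ true → c ≡ true) → (b ≡ true → c ≡ true) →
    (a ≡ true → b ≢ true) → ⟨ a ⟩ + ⟨ b ⟩ ≤ ⟨ c ⟩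
  pointwise {false} _ q _ = ⟨⟩-mono q
  pointwise {true} {false} p _ _ = ⟨⟩-mono p
  pointwise {true} {true} _ _ d = ⊥-elim (d refl refl)

#-cover : (P Q R : Subset n) → (∀ v → v ∈ R → (v ∈ P) ⊎ (v ∈ Q)) → # R ≤ # P + # Q
#-cover P Q R c = subst (# R ≤_) (∑-+ (λ v → ⟨ P v ⟩) _) (∑-mono λ v → pointwise (c v))
  where
  pointwise : ∀ {a b c} → (c ≡ true → (a ≡ true) ⊎ (b ≡ true)) → ⟨ c ⟩ ≤ ⟨ a ⟩ + ⟨ b ⟩
  pointwise {c = false} _ = z≤n
  pointwise {a = a} {b} {true} p with p refl
  ... | inj₁ refl = s≤s z≤n
  ... | inj₂ refl = ℕ.m≤n+m 1 ⟨ a ⟩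

#-∁ : (P : Subset n) → # P + # (∁ P) ≡ 2 ^ n
#-∁ {n} P = begin
  # P + # (∁ P)  ≡⟨ ∑-+ (λ v → ⟨ P v ⟩) _ ⟨
  ∑ (λ v → ⟨ P v ⟩ + ⟨ not (P v) ⟩)  ≡⟨ ∑-cong (λ v → one (P v)) ⟩
  ∑ {n} (λ _ → 1)  ≡⟨ ∑-const n 1 ⟩
  2 ^ n * 1  ≡⟨ ℕ.*-identityʳ _ ⟩
  2 ^ n  ∎
  where
  open ≡-Reasoning
  one : ∀ b → ⟨ b ⟩ + ⟨ not b ⟩ ≡ 1
  one false = refl
  one true = refl

any : Subset n → Bool
any {zero} P = P []
any {suc n} P = any (P ∘ (false ∷_)) ∨ any (P ∘ (true ∷_))

any-intro : (P : Subset n) (v : V n) → v ∈ P → any P ≡ true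
any-intro P [] p = p
any-intro P (false ∷ v) p rewrite any-intro (P ∘ (false ∷_)) v p = refl
any-intro P (true ∷ v) p rewrite any-intro (P ∘ (true ∷_)) v p = 𝔹.∨-zeroʳ _

any-elim : (P : Subset n) → any P ≡ true → ∃ λ v → v ∈ P
any-elim {zero} P p = [] , p
any-elim {suc n} P p with any (P ∘ (false ∷_)) in eq
... | true with v , q ← any-elim (P ∘ (false ∷_)) eq = (false ∷ v) , q
... | false with v , q ← any-elim (P ∘ (true ∷_)) p = (true ∷ v) , q

search : (P : Subset n) → (∃ λ v → v ∈ P) ⊎ (∀ v → ¬ v ∈ P)
search P with any P in eq
... | true = inj₁ (any-elim P eq)
... | false = inj₂ (λ v v∈P → false≢true eq (any-intro P v v∈P))

#-empty : (P : Subset n) → (∀ v → ¬ v ∈ P) → # P ≤ 0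
#-empty {zero} P p = ℕ.≤-trans (⟨⟩-mono {b = false} (λ q → ⊥-elim (p [] q))) z≤n
#-empty {suc n} P p =
  ℕ.+-mono-≤ (#-empty (P ∘ (false ∷_)) (p ∘ (false ∷_))) (#-empty (P ∘ (true ∷_)) (p ∘ (true ∷_)))

#-inhabited : (P : Subset n) (v : V n) → v ∈ P → 1 ≤ # P
#-inhabited P v p = subst (λ b → ⟨ b ⟩ ≤ # P) p (term≤∑ (λ v → ⟨ P v ⟩) v)

#-positive : (P : Subset n) → 0 < # P → ∃ λ v → v ∈ P
#-positive P pos with search P
... | inj₁ found = found
... | inj₂ none = ⊥-elim (ℕ.<⇒≱ pos (#-empty P none))

#-subsingleton : (P : Subset n) → (∀ u v → u ∈ P → v ∈ P → u ≡ v) → # P ≤ 1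
#-subsingleton {zero} P p = ⟨⟩-mono {b = true} (λ _ → refl)
#-subsingleton {suc n} P p with search (P ∘ (true ∷_))
... | inj₁ (v , v∈P) = ℕ.+-mono-≤
  (#-empty (P ∘ (false ∷_)) (λ u u∈P → case p _ _ u∈P v∈P of λ ()))
  (#-subsingleton (P ∘ (true ∷_)) (λ u w a b → ∷-injectiveʳ (p _ _ a b)))
... | inj₂ none = ℕ.≤-trans (ℕ.+-mono-≤
  (#-subsingleton (P ∘ (false ∷_)) (λ u w a b → ∷-injectiveʳ (p _ _ a b)))
  (#-empty (P ∘ (true ∷_)) none)) ℕ.≤-refl

_==_ : V n → V n → Bool
u == v = ⌊ ≡-dec 𝔹._≟_ u v ⌋

==-sound : (u v : V n) → u == v ≡ true → u ≡ v
==-sound u v p with ≡-dec 𝔹._≟_ u v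
... | yes q = q
... | no _ with () ← p

==-refl : (u v : V n) → u ≡ v → u == v ≡ true
==-refl u v q with ≡-dec 𝔹._≟_ u v
... | yes _ = refl
... | no ¬q = ⊥-elim (¬q q)

-- Counts the pairs (v, f v) with f v in `P`, first by v and then by w = f v; injectivity leaves at
-- most one v for each w.
#-preimage : (f : s ⊸ r) → Inj f → (P : Subset r) → # (λ v → P (f $ v)) ≤ # P
#-preimage {s} f inj P = begin
  # (λ v → P (f $ v))
    ≤⟨ ∑-mono (λ v → ℕ.≤-trans (⟨⟩-mono (λ p → ∩-intro p (==-refl (f $ v) _ refl))) (term≤∑ (λ w → pair v w) (f $ v))) ⟩
  ∑ (λ v → ∑ (λ w → pair v w))       ≡⟨ ∑-swap pair ⟩
  ∑ (λ w → ∑ (λ v → pair v w))       ≤⟨ ∑-mono fibre ⟩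
  # P                              ∎
  where
  open ℕ.≤-Reasoning
  pair : _ → _ → ℕ
  pair v w = ⟨ P w ∧ ((f $ v) == w) ⟩
  fibre : ∀ w → ∑ (λ v → pair v w) ≤ ⟨ P w ⟩
  fibre w with P w
  ... | false = #-empty {s} (λ _ → false) (λ _ ())
  ... | true = #-subsingleton (λ v → (f $ v) == w)
    (λ u v a b → inj u v (trans (==-sound _ w a) (sym (==-sound _ w b))))

-- `Q` lies in a union of 2^k translates of `P`. When `g` parametrises a subspace T and `P` meets
-- every coset of T in `Q`, this reads |Q| ≤ |T||P|.
#-translates : (g : V k → V n) (P Q : Subset n) →
  (∀ v → v ∈ Q → ∃ λ t → (v ⊕ g t) ∈ P) → # Q ≤ 2 ^ k * # P
#-translates {k} g P Q cover = begin
  # Q                                     ≤⟨ ∑-mono covered ⟩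
  ∑ (λ v → ∑ (λ t → ⟨ P (v ⊕ g t) ⟩))       ≡⟨ ∑-swap (λ v t → ⟨ P (v ⊕ g t) ⟩) ⟩
  ∑ (λ t → # (λ v → P (v ⊕ g t)))         ≡⟨ ∑-cong (λ t → #-translate (g t) P) ⟩
  ∑ {k} (λ t → # P)                       ≡⟨ ∑-const k (# P) ⟩
  2 ^ k * # P                             ∎
  where
  open ℕ.≤-Reasoning
  covered : ∀ v → ⟨ Q v ⟩ ≤ ∑ (λ t → ⟨ P (v ⊕ g t) ⟩)
  covered v with Q v in eq
  ... | false = z≤n
  ... | true with t , p ← cover v eq = #-inhabited (λ t → P (v ⊕ g t)) t p

-- By surjectivity any two fibres are translates of each other, and the 2^k fibres partition 𝔽₂ⁿ.
#-fibre : (φ : n ⊸ k) → Onto φ → ∀ c → 2 ^ k * # (λ v → (φ $ v) == c) ≡ 2 ^ n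
#-fibre {n} {k} φ onto c = begin
  2 ^ k * # (fibre c)                    ≡⟨ ∑-const k (# (fibre c)) ⟨
  ∑ {k} (λ _ → # (fibre c))              ≡⟨ ∑-cong same ⟩
  ∑ (λ d → # (fibre d))                  ≡⟨ ∑-swap (λ v d → ⟨ fibre d v ⟩) ⟨
  ∑ (λ v → # (λ d → (φ $ v) == d))     ≡⟨ ∑-cong (λ v → singleton (φ $ v)) ⟩
  ∑ {n} (λ _ → 1)                        ≡⟨ ∑-const n 1 ⟩
  2 ^ n * 1                              ≡⟨ ℕ.*-identityʳ _ ⟩
  2 ^ n                                  ∎
  where
  open ≡-Reasoning
  fibre : V k → Subset n
  fibre d v = (φ $ v) == d
  singleton : ∀ w → # (λ d → w == d) ≡ 1
  singleton w = ℕ.≤-antisym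
    (#-subsingleton (w ==_) (λ a b p q → trans (sym (==-sound w a p)) (==-sound w b q)))
    (#-inhabited (w ==_) w (==-refl w w refl))
  ≤-same : ∀ d d′ → # (fibre d) ≤ # (fibre d′)
  ≤-same d d′ with t , φt ← onto (d ⊕ d′) = subst (# (fibre d) ≤_) (#-translate t (fibre d′))
    (#-mono (fibre d) _ λ v v∈ → ==-refl _ d′ (begin
      φ $ (v ⊕ t)        ≡⟨ φ .additive v t ⟩
      (φ $ v) ⊕ (φ $ t)  ≡⟨ cong₂ _⊕_ (==-sound _ d v∈) φt ⟩
      d ⊕ (d ⊕ d′)       ≡⟨ ⊕-cancelˡ d d′ ⟩
      d′                 ∎))
  same : ∀ d → # (fibre c) ≡ # (fibre d)
  same d = ℕ.≤-antisym (≤-same c d) (≤-same d c)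

#-∪-∩ : (P Q : Subset n) → # P + # Q ≤ # (P ∪ Q) + # (P ∩ Q)
#-∪-∩ P Q = subst₂ _≤_ (∑-+ (λ v → ⟨ P v ⟩) _) (∑-+ (λ v → ⟨ P v ∨ Q v ⟩) _)
  (∑-mono λ v → pointwise (P v) (Q v))
  where
  pointwise : ∀ a b → ⟨ a ⟩ + ⟨ b ⟩ ≤ ⟨ a ∨ b ⟩ + ⟨ a ∧ b ⟩
  pointwise false b = ℕ.m≤m+n _ _
  pointwise true b = ℕ.≤-refl

∪-elim : ∀ {a b} → a ∨ b ≡ true → (a ≡ true) ⊎ (b ≡ true)
∪-elim {true} _ = inj₁ refl
∪-elim {false} p = inj₂ p

∪-introˡ : ∀ {a b} → a ≡ true → a ∨ b ≡ true
∪-introˡ refl = refl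

∪-introʳ : ∀ {a b} → b ≡ true → a ∨ b ≡ true
∪-introʳ {true} _ = refl
∪-introʳ {false} p = p

-- Both sides count ordered pairs of elements of `P`, on the left sorted by their difference `d`.
∑-autocorrelation : (P : Subset n) → ∑ (λ d → # (P ∩ (λ v → P (v ⊕ d)))) ≡ # P * # P
∑-autocorrelation {n} P = begin
  ∑ (λ d → ∑ (λ v → ⟨ P v ∧ P (v ⊕ d) ⟩))    ≡⟨ ∑-swap (λ d v → ⟨ P v ∧ P (v ⊕ d) ⟩) ⟩
  ∑ (λ v → ∑ (λ d → ⟨ P v ∧ P (v ⊕ d) ⟩))    ≡⟨ ∑-cong inner ⟩
  ∑ (λ v → # P * ⟨ P v ⟩)                  ≡⟨ ∑-*ˡ (# P) (λ v → ⟨ P v ⟩) ⟩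
  # P * # P                              ∎
  where
  open ≡-Reasoning
  inner : ∀ v → ∑ (λ d → ⟨ P v ∧ P (v ⊕ d) ⟩) ≡ # P * ⟨ P v ⟩
  inner v with P v
  ... | true = begin
    ∑ (λ d → ⟨ P (v ⊕ d) ⟩)  ≡⟨ ∑-cong (λ d → cong (λ z → ⟨ P z ⟩) (⊕-comm v d)) ⟩
    ∑ (λ d → ⟨ P (d ⊕ v) ⟩)  ≡⟨ #-translate v P ⟩
    # P                    ≡⟨ ℕ.*-identityʳ _ ⟨
    # P * 1                ∎
  ... | false = trans (∑-const n 0) (trans (ℕ.*-zeroʳ (2 ^ n)) (sym (ℕ.*-zeroʳ (# P))))

Onto-functional : (ψ : n ⊸ 1) (v : V n) → (ψ $ v) ≡ true ∷ [] → Onto ψ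
Onto-functional ψ v p (true ∷ []) = v , p
Onto-functional ψ v p (false ∷ []) = 0v , $-0v ψ

-- Dense triangle-free sets are affine

Triangle-free : Subset n → Set
Triangle-free S = ∀ x y → x ∈ S → y ∈ S → ¬ (x ⊕ y) ∈ S

Affine : Subset n → Set
Affine {n} S = Σ (n ⊸ 1) λ ψ → ∀ v → v ∈ S → (ψ $ v) ≡ true ∷ []

pattern 𝟎 = false ∷ false ∷ []
pattern 𝟏 = false ∷ true ∷ []
pattern 𝟐 = true ∷ false ∷ []
pattern 𝟑 = true ∷ true ∷ []

-- `q` is the order of K, the kernel of `φ`. Class 𝟎 is K itself; 𝟏, 𝟐 and 𝟑 are its other cosets.
module Classes {n q} (4q≡2^n : 4 * q ≡ 2 ^ n) (φ : n ⊸ 2) (φ-onto : Onto φ)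
               (S : Subset n) (S-free : Triangle-free S) where

  Class X : V 2 → Subset n
  Class c v = (φ $ v) == c
  X c = S ∩ Class c

  #-Class : ∀ c → # (Class c) ≡ q
  #-Class c = ℕ.*-cancelˡ-≡ _ _ 4 (trans (#-fibre φ φ-onto c) (sym 4q≡2^n))

  x : V 2 → ℕ
  x c = # (X c)

  class-of : ∀ {v} c → v ∈ X c → (φ $ v) ≡ c
  class-of c p = ==-sound _ c (∩-elimʳ p)

  class-⊕ : ∀ {u v} c d → (φ $ u) ≡ c → (φ $ v) ≡ d → (φ $ (u ⊕ v)) ≡ c ⊕ d
  class-⊕ c d p r = trans (φ .additive _ _) (cong₂ _⊕_ p r)

  class-shift : ∀ {v a} c d → (v ⊕ a) ∈ X c → (φ $ a) ≡ d → (φ $ v) ≡ c ⊕ d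
  class-shift {v} {a} c d p r =
    subst (λ z → (φ $ z) ≡ c ⊕ d) (⊕-cancelʳ v a) (class-⊕ c d (class-of c p) r)

  -- The translate `X c` + a lies in class `d` and misses `X d`, since v, a and v + a cannot all be
  -- in `S`. The case `e` = 𝟎, `d` = `c` gives 2|X c| ≤ q as soon as `S` meets K.
  x+x≤q : ∀ c d e {a} → c ⊕ e ≡ d → a ∈ X e → x c + x d ≤ q
  x+x≤q c d e {a} c⊕e≡d a∈ = subst₂ (λ s t → s + x d ≤ t) (#-translate a (X c)) (#-Class d)
    (#-disjoint (λ v → X c (v ⊕ a)) (X d) (Class d)
      (λ v p → ==-refl _ d (trans (class-shift c e p (class-of e a∈)) c⊕e≡d))
      (λ v p → ∩-elimʳ p)
      (λ v p r → S-free v a (∩-elimˡ r) (∩-elimˡ a∈) (∩-elimˡ p)))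

  -- `S` also misses K: an element there would force 2 x i ≤ q and 2 x j ≤ q, against the density.
  -- So `S` lies in the classes where `h` is 1.
  affine-if-class-missed : ∀ i j k (h : 2 ⊸ 1) →
    (∀ c → (c ≡ 𝟎) ⊎ (c ≡ k) ⊎ ((h $ c) ≡ true ∷ [])) →
    7 * q < 5 * (x i + x j) → (∀ v → ¬ v ∈ X k) → Affine S
  affine-if-class-missed i j k h kernel large none = h ⊚ φ , λ v v∈S → value v v∈S (kernel (φ $ v))
    where
    no-zero-class : ∀ {v} → ¬ v ∈ X 𝟎
    no-zero-class v∈ = ℕ.<⇒≱ large (begin
      5 * (x i + x j)  ≤⟨ ℕ.*-monoʳ-≤ 5 x+x≤ ⟩
      5 * q            ≤⟨ ℕ.*-monoˡ-≤ q (ℕ.m≤m+n 5 2) ⟩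
      7 * q            ∎)
      where
      open ℕ.≤-Reasoning
      double : ∀ a b → 2 * (a + b) ≡ (a + a) + (b + b)
      double = solve-∀
      2* : ∀ q → q + q ≡ 2 * q
      2* = solve-∀
      x+x≤ : x i + x j ≤ q
      x+x≤ = ℕ.*-cancelˡ-≤ 2 (begin
        2 * (x i + x j)            ≡⟨ double (x i) (x j) ⟩
        (x i + x i) + (x j + x j)
          ≤⟨ ℕ.+-mono-≤ (x+x≤q i i 𝟎 (⊕-identityʳ i) v∈) (x+x≤q j j 𝟎 (⊕-identityʳ j) v∈) ⟩
        q + q                      ≡⟨ 2* q ⟩
        2 * q                      ∎)
    value : ∀ v → v ∈ S → ((φ $ v) ≡ 𝟎) ⊎ ((φ $ v) ≡ k) ⊎ ((h $ φ $ v) ≡ true ∷ []) →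
      (h $ φ $ v) ≡ true ∷ []
    value v v∈S (inj₁ p) = ⊥-elim (no-zero-class (∩-intro v∈S (==-refl _ 𝟎 p)))
    value v v∈S (inj₂ (inj₁ p)) = ⊥-elim (none v (∩-intro v∈S (==-refl _ k p)))
    value v v∈S (inj₂ (inj₂ p)) = p

  Above : V 2 → Set
  Above c = 2 * q < 5 * x c

  common : V 2 → V n → ℕ
  common c d = # (X c ∩ (λ v → X c (v ⊕ d)))

  -- X i + a and X i + a′ both lie in class k and avoid X k.
  common-bound : ∀ i j k {a a′} → i ⊕ j ≡ k → a ∈ X j → a′ ∈ X j →
    (x i + x i) + x k ≤ q + common i (a ⊕ a′)
  common-bound i j k {a} {a′} i⊕j≡k a∈ a′∈ = begin
    (x i + x i) + x k
      ≡⟨ cong₂ (λ s t → (s + t) + x k) (#-translate a (X i)) (#-translate a′ (X i)) ⟨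
    (# P + # P′) + x k                   ≤⟨ ℕ.+-monoˡ-≤ (x k) (#-∪-∩ P P′) ⟩
    (# (P ∪ P′) + # (P ∩ P′)) + x k          ≡⟨ swap₂₃ (# (P ∪ P′)) _ _ ⟩
    (# (P ∪ P′) + x k) + # (P ∩ P′)          ≤⟨ ℕ.+-mono-≤ union≤ inter≤ ⟩
    q + common i (a ⊕ a′)                   ∎
    where
    open ℕ.≤-Reasoning
    swap₂₃ : ∀ a b c → (a + b) + c ≡ (a + c) + b
    swap₂₃ = solve-∀
    P P′ : Subset n
    P v = X i (v ⊕ a)
    P′ v = X i (v ⊕ a′)
    in-class : ∀ {v b} → b ∈ X j → (v ⊕ b) ∈ X i → v ∈ Class k
    in-class b∈ p = ==-refl _ k (trans (class-shift i j p (class-of j b∈)) i⊕j≡k)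
    union≤ : (# (P ∪ P′)) + x k ≤ q
    union≤ = subst (# (P ∪ P′) + x k ≤_) (#-Class k) (#-disjoint (P ∪ P′) (X k) (Class k)
      (λ v p → [ in-class a∈ , in-class a′∈ ]′ (∪-elim p))
      (λ v p → ∩-elimʳ p)
      (λ v p r → [ (λ s → S-free v a (∩-elimˡ r) (∩-elimˡ a∈) (∩-elimˡ s))
                          , (λ s → S-free v a′ (∩-elimˡ r) (∩-elimˡ a′∈) (∩-elimˡ s)) ]′ (∪-elim p)))
    inter≤ : (# (P ∩ P′)) ≤ common i (a ⊕ a′)
    inter≤ = subst (_≤ common i (a ⊕ a′)) (#-translate a (P ∩ P′))
      (#-mono (λ v → (P ∩ P′) (v ⊕ a)) _ λ v p → ∩-intro
        (subst (_∈ X i) (⊕-cancelʳ v a) (∩-elimˡ {P (v ⊕ a)} p))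
        (subst (_∈ X i) (⊕-assoc v a a′) (∩-elimʳ {P (v ⊕ a)} p)))

  -- `X i` + `X j` avoids `X k` inside class `k`, so it has at most q - x k < 3q/5 < 3(x i)/2
  -- elements. Two translates of `X i` inside it share more than (x i)/2. In numbers, `common-bound`
  -- reduces the claim to 3 x i + 2 x k > 2q.
  half-common : ∀ i j k {a a′} → i ⊕ j ≡ k → Above i → Above k → a ∈ X j → a′ ∈ X j →
    x i < 2 * common i (a ⊕ a′)
  half-common i j k {a} {a′} i⊕j≡k above-i above-k a∈ a′∈ =
    ℕ.*-cancelˡ-< 5 (x i) _ (ℕ.+-cancelˡ-< (10 * q) _ _ (begin-strict
      10 * q + 5 * x i                              ≡⟨ e₁ q (x i) ⟩
      (3 * (2 * q) + 2 * (2 * q)) + 5 * x i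
        <⟨ ℕ.+-monoˡ-< (5 * x i) (ℕ.+-mono-< (ℕ.*-monoʳ-< 3 above-i) (ℕ.*-monoʳ-< 2 above-k)) ⟩
      (3 * (5 * x i) + 2 * (5 * x k)) + 5 * x i     ≡⟨ e₂ (x i) (x k) ⟩
      10 * ((x i + x i) + x k)                      ≤⟨ ℕ.*-monoʳ-≤ 10 (common-bound i j k i⊕j≡k a∈ a′∈) ⟩
      10 * (q + common i (a ⊕ a′))                 ≡⟨ e₃ q _ ⟩
      10 * q + 5 * (2 * common i (a ⊕ a′))         ∎))
    where
    open ℕ.≤-Reasoning
    e₁ : ∀ q x → 10 * q + 5 * x ≡ (3 * (2 * q) + 2 * (2 * q)) + 5 * x
    e₁ = solve-∀
    e₂ : ∀ x y → (3 * (5 * x) + 2 * (5 * y)) + 5 * x ≡ 10 * ((x + x) + y)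
    e₂ = solve-∀
    e₃ : ∀ q r → 10 * (q + r) ≡ 10 * q + 5 * (2 * r)
    e₃ = solve-∀

  -- The sumset `X c` + `X c`, which in characteristic 2 is the set of differences.
  Diff : V 2 → Subset n
  Diff c d = any (X c ∩ (λ v → X c (v ⊕ d)))

  Diff-intro : ∀ c {a a′} → a ∈ X c → a′ ∈ X c → (a ⊕ a′) ∈ Diff c
  Diff-intro c {a} {a′} p r =
    any-intro (X c ∩ _) a (∩-intro p (subst (_∈ X c) (sym (⊕-cancelˡ a a′)) r))

  Diff-elim : ∀ c {d} → d ∈ Diff c → ∃ λ v → v ∈ X c × (v ⊕ d) ∈ X c
  Diff-elim c {d} p with v , r ← any-elim (X c ∩ (λ v → X c (v ⊕ d))) p = v , ∩-elimˡ r , ∩-elimʳ {X c v} r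

  Diff-half : ∀ i j k {d} → i ⊕ j ≡ k → Above i → Above k → d ∈ Diff j → x i < 2 * common i d
  Diff-half i j k {d} i⊕j≡k above-i above-k d∈ with v , p , r ← Diff-elim j d∈ =
    subst (λ z → x i < 2 * common i z) (⊕-cancelˡ v d) (half-common i j k i⊕j≡k above-i above-k p r)

  -- The overlap bounded below by `Diff-half` is nonempty, and any point of it exhibits `d` as a
  -- difference in `X i`.
  Diff-⊆ : ∀ i j k {d} → i ⊕ j ≡ k → Above i → Above k → d ∈ Diff j → d ∈ Diff i
  Diff-⊆ i j k {d} i⊕j≡k above-i above-k d∈ = any-intro (X i ∩ (λ v → X i (v ⊕ d))) (proj₁ found) (proj₂ found)
    where
    positive : ∀ {x r} → x < 2 * r → 0 < r
    positive {r = suc _} _ = s≤s z≤n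
    found : ∃ λ v → v ∈ X i ∩ (λ v → X i (v ⊕ d))
    found = #-positive (X i ∩ (λ v → X i (v ⊕ d))) (positive (Diff-half i j k i⊕j≡k above-i above-k d∈))

  -- Three parts above 2q/5 would together exceed the q elements of the class. Applied to translates
  -- of the `X c`, this forces two of them to overlap.
  no-three-disjoint : ∀ c (P Q R : Subset n) →
    (∀ v → v ∈ P → v ∈ Class c) → (∀ v → v ∈ Q → v ∈ Class c) → (∀ v → v ∈ R → v ∈ Class c) →
    (∀ v → v ∈ P → ¬ v ∈ Q) → (∀ v → v ∈ P → ¬ v ∈ R) → (∀ v → v ∈ Q → ¬ v ∈ R) →
    2 * q < 5 * # P → 2 * q < 5 * # Q → 2 * q < 5 * # R → ⊥
  no-three-disjoint c P Q R P⊆ Q⊆ R⊆ P∩Q P∩R Q∩R p-large q-large r-large =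
    ℕ.<⇒≱ (begin-strict
      6 * q                                   ≡⟨ e₁ q ⟩
      2 * q + (2 * q + 2 * q)                 <⟨ ℕ.+-mono-< p-large (ℕ.+-mono-< q-large r-large) ⟩
      5 * # P + (5 * # Q + 5 * # R)      ≡⟨ e₂ (# P) (# Q) (# R) ⟩
      5 * (# P + (# Q + # R))
        ≤⟨ ℕ.*-monoʳ-≤ 5 (ℕ.+-monoʳ-≤ (# P) (#-disjoint Q R (Q ∪ R) (λ _ → ∪-introˡ) (λ _ → ∪-introʳ) Q∩R)) ⟩
      5 * (# P + # (Q ∪ R))                  ≤⟨ ℕ.*-monoʳ-≤ 5 (#-disjoint P (Q ∪ R) (Class c) P⊆
                                                   (λ v p → [ Q⊆ v , R⊆ v ]′ (∪-elim p))
                                                   (λ v p r → [ P∩Q v p , P∩R v p ]′ (∪-elim r))) ⟩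
      5 * # (Class c)                         ≡⟨ cong (5 *_) (#-Class c) ⟩
      5 * q                                   ∎) (ℕ.*-monoˡ-≤ q (ℕ.m≤m+n 5 1))
    where
    open ℕ.≤-Reasoning
    e₁ : ∀ q → 6 * q ≡ 2 * q + (2 * q + 2 * q)
    e₁ = solve-∀
    e₂ : ∀ a b c → 5 * a + (5 * b + 5 * c) ≡ 5 * (a + (b + c))
    e₂ = solve-∀

  module All-classes-occupied
    (a₁ a₂ a₃ : V n) (a₁∈ : a₁ ∈ X 𝟏) (a₂∈ : a₂ ∈ X 𝟐) (a₃∈ : a₃ ∈ X 𝟑)
    (dense : 7 * q < 5 * (x 𝟏 + x 𝟐 + x 𝟑)) where

    x₁+x₂≤q : x 𝟏 + x 𝟐 ≤ q
    x₁+x₂≤q = x+x≤q 𝟏 𝟐 𝟑 refl a₃∈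

    -- Two occupied classes hold at most q by `x+x≤q`, which leaves more than 7q/5 - q = 2q/5 for
    -- the third.
    third-above : ∀ s t → 7 * q < 5 * (s + t) → s ≤ q → 2 * q < 5 * t
    third-above s t lt s≤q = ℕ.+-cancelˡ-< (5 * q) _ _ (begin-strict
      5 * q + 2 * q  ≡⟨ ℕ.*-distribʳ-+ q 5 2 ⟨
      7 * q          <⟨ lt ⟩
      5 * (s + t)    ≡⟨ ℕ.*-distribˡ-+ 5 s t ⟩
      5 * s + 5 * t  ≤⟨ ℕ.+-monoˡ-≤ (5 * t) (ℕ.*-monoʳ-≤ 5 s≤q) ⟩
      5 * q + 5 * t  ∎)
      where open ℕ.≤-Reasoning

    above₁ : Above 𝟏
    above₁ = third-above (x 𝟐 + x 𝟑) (x 𝟏) (subst (λ z → 7 * q < 5 * z) (rotate (x 𝟏) (x 𝟐) (x 𝟑)) dense)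
      (x+x≤q 𝟐 𝟑 𝟏 refl a₁∈)
      where
      rotate : ∀ a b c → a + b + c ≡ (b + c) + a
      rotate = solve-∀

    above₂ : Above 𝟐
    above₂ = third-above (x 𝟏 + x 𝟑) (x 𝟐) (subst (λ z → 7 * q < 5 * z) (swap₂₃ (x 𝟏) (x 𝟐) (x 𝟑)) dense)
      (x+x≤q 𝟏 𝟑 𝟐 refl a₂∈)
      where
      swap₂₃ : ∀ a b c → (a + b) + c ≡ (a + c) + b
      swap₂₃ = solve-∀

    above₃ : Above 𝟑
    above₃ = third-above (x 𝟏 + x 𝟐) (x 𝟑) dense x₁+x₂≤q

    -- By the inclusions that follow, this is also `Diff 𝟐` and contains `Diff 𝟑`. It turns out to
    -- be a subgroup of index 2 in K.
    G : Subset n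
    G = Diff 𝟏

    G⊆Diff₂ : ∀ {d} → d ∈ G → d ∈ Diff 𝟐
    G⊆Diff₂ = Diff-⊆ 𝟐 𝟏 𝟑 refl above₂ above₃

    Diff₂⊆G : ∀ {d} → d ∈ Diff 𝟐 → d ∈ G
    Diff₂⊆G = Diff-⊆ 𝟏 𝟐 𝟑 refl above₁ above₃

    Diff₃⊆G : ∀ {d} → d ∈ Diff 𝟑 → d ∈ G
    Diff₃⊆G = Diff-⊆ 𝟏 𝟑 𝟐 refl above₁ above₂

    G-half₁ : ∀ {d} → d ∈ G → x 𝟏 < 2 * common 𝟏 d
    G-half₁ d∈ = Diff-half 𝟏 𝟐 𝟑 refl above₁ above₃ (G⊆Diff₂ d∈)

    G-half₂ : ∀ {d} → d ∈ G → x 𝟐 < 2 * common 𝟐 d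
    G-half₂ = Diff-half 𝟐 𝟏 𝟑 refl above₂ above₃

    -- The v in `X 𝟏` with v + d in `X 𝟏` form more than half of it, and likewise for d′. Some v
    -- serves both, and (v + d) + (v + d′) = d + d′.
    G-closed : ∀ {d d′} → d ∈ G → d′ ∈ G → (d ⊕ d′) ∈ G
    G-closed {d} {d′} d∈ d′∈ = translated found
      where
      open ℕ.≤-Reasoning
      P P′ : Subset n
      P = X 𝟏 ∩ (λ v → X 𝟏 (v ⊕ d))
      P′ = X 𝟏 ∩ (λ v → X 𝟏 (v ⊕ d′))
      union : ∀ v → v ∈ P ∪ P′ → v ∈ X 𝟏
      union v p = [ ∩-elimˡ , ∩-elimˡ ]′ (∪-elim {P v} p)
      more : x 𝟏 < x 𝟏 + # (P ∩ P′)
      more = ℕ.*-cancelˡ-< 2 (x 𝟏) _ (begin-strict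
        2 * x 𝟏                          ≡⟨ double (x 𝟏) ⟩
        x 𝟏 + x 𝟏                        <⟨ ℕ.+-mono-< (G-half₁ d∈) (G-half₁ d′∈) ⟩
        2 * # P + 2 * # P′               ≡⟨ ℕ.*-distribˡ-+ 2 (# P) (# P′) ⟨
        2 * (# P + # P′)                 ≤⟨ ℕ.*-monoʳ-≤ 2 (#-∪-∩ P P′) ⟩
        2 * (# (P ∪ P′) + # (P ∩ P′))
          ≤⟨ ℕ.*-monoʳ-≤ 2 (ℕ.+-monoˡ-≤ (# (P ∩ P′)) (#-mono (P ∪ P′) (X 𝟏) union)) ⟩
        2 * (x 𝟏 + # (P ∩ P′))           ∎)
        where
        double : ∀ a → 2 * a ≡ a + a
        double = solve-∀
      found : ∃ λ v → v ∈ P ∩ P′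
      found = #-positive (P ∩ P′) (ℕ.+-cancelˡ-< (x 𝟏) 0 _ (subst (_< x 𝟏 + # (P ∩ P′)) (sym (ℕ.+-identityʳ _)) more))
      translated : (∃ λ v → v ∈ P ∩ P′) → (d ⊕ d′) ∈ G
      translated (v , p) = subst (_∈ G) (⊕-solve (v ∷ d ∷ d′ ∷ []) ((x₀ ⊞ x₁) ⊞ (x₀ ⊞ x₂)) (x₁ ⊞ x₂) refl)
        (Diff-intro 𝟏 (∩-elimʳ {X 𝟏 v} (∩-elimˡ {P v} p)) (∩-elimʳ {X 𝟏 v} (∩-elimʳ {P v} p)))

    -- Summed over K, the overlaps give at most x², where x = `x c`. If each exceeds x/2, then q(x +
    -- 1) ≤ 2x², which 2x ≤ q would contradict. The `suc` records the strictness of the overlap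
    -- bound.
    dense-if-all-overlap : ∀ c → (∀ d → d ∈ Class 𝟎 → x c < 2 * common c d) → q < 2 * x c
    dense-if-all-overlap c all = ℕ.≰⇒> λ 2x≤q → ℕ.<⇒≱ (lower (x c) q-positive) (begin
      q * suc (x c)                              ≡⟨ ℕ.*-comm q _ ⟩
      suc (x c) * q                              ≡⟨ cong (suc (x c) *_) (#-Class 𝟎) ⟨
      suc (x c) * # (Class 𝟎)                    ≡⟨ ∑-*ˡ (suc (x c)) (λ d → ⟨ Class 𝟎 d ⟩) ⟨
      ∑ (λ d → suc (x c) * ⟨ Class 𝟎 d ⟩)        ≤⟨ ∑-mono (λ d → pointwise d) ⟩
      ∑ (λ d → 2 * common c d)                   ≡⟨ ∑-*ˡ 2 (common c) ⟩
      2 * ∑ (common c)                           ≡⟨ cong (2 *_) (∑-autocorrelation (X c)) ⟩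
      2 * (x c * x c)                            ≡⟨ ℕ.*-assoc 2 (x c) _ ⟨
      2 * x c * x c                              ≤⟨ ℕ.*-monoˡ-≤ (x c) 2x≤q ⟩
      q * x c                                    ∎)
      where
      open ℕ.≤-Reasoning
      q-positive : 0 < q
      q-positive = subst (0 <_) (#-Class 𝟎) (#-inhabited (Class 𝟎) 0v (==-refl _ 𝟎 ($-0v φ)))
      lower : ∀ {q} y → 0 < q → q * y < q * suc y
      lower {suc q} y _ = ℕ.*-monoʳ-< (suc q) ℕ.≤-refl
      pointwise : ∀ d → suc (x c) * ⟨ Class 𝟎 d ⟩ ≤ 2 * common c d
      pointwise d with Class 𝟎 d in eq
      ... | true = subst (_≤ 2 * common c d) (sym (ℕ.*-identityʳ _)) (all d eq)
      ... | false = subst (_≤ 2 * common c d) (sym (ℕ.*-zeroʳ (suc (x c)))) z≤n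

    -- If `G` were all of K, both `x 𝟏` and `x 𝟐` would exceed q/2, although their sum is at most q.
    outside-G : ∃ λ u → u ∈ Class 𝟎 × ¬ u ∈ G
    outside-G with search (Class 𝟎 ∩ ∁ G)
    ... | inj₁ (u , p) = u , ∩-elimˡ p , ∁-elim (∩-elimʳ {Class 𝟎 u} p)
    ... | inj₂ none = ⊥-elim (ℕ.<⇒≱ (ℕ.+-mono-< dense₁ dense₂) (begin
      2 * x 𝟏 + 2 * x 𝟐  ≡⟨ ℕ.*-distribˡ-+ 2 (x 𝟏) _ ⟨
      2 * (x 𝟏 + x 𝟐)    ≤⟨ ℕ.*-monoʳ-≤ 2 x₁+x₂≤q ⟩
      2 * q              ≡⟨ double q ⟩
      q + q              ∎))
      where
      open ℕ.≤-Reasoning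
      double : ∀ a → 2 * a ≡ a + a
      double = solve-∀
      in-G : ∀ d → d ∈ Class 𝟎 → d ∈ G
      in-G d d∈ with G d in eq
      ... | true = refl
      ... | false = ⊥-elim (none d (∩-intro d∈ (cong not eq)))
      dense₁ : q < 2 * x 𝟏
      dense₁ = dense-if-all-overlap 𝟏 (λ d d∈ → G-half₁ (in-G d d∈))
      dense₂ : q < 2 * x 𝟐
      dense₂ = dense-if-all-overlap 𝟐 (λ d d∈ → G-half₂ (in-G d d∈))

    shift-above : ∀ c t → Above c → 2 * q < 5 * # (λ v → X c (v ⊕ t))
    shift-above c t = subst (λ z → 2 * q < 5 * z) (sym (#-translate t (X c)))

    shift-class : ∀ c d e {t} → c ⊕ e ≡ d → (φ $ t) ≡ e → ∀ v → (v ⊕ t) ∈ X c → v ∈ Class d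
    shift-class c d e eq φt v p = ==-refl _ d (trans (class-shift c e p φt) eq)

    -- With u, v and u + v all outside `G`, the sets `X 𝟏`, `X 𝟏` + u and `X 𝟏` + v would be
    -- pairwise disjoint.
    G-index-2 : ∀ {u v} → u ∈ Class 𝟎 → v ∈ Class 𝟎 → ¬ u ∈ G → ¬ v ∈ G → (u ⊕ v) ∈ G
    G-index-2 {u} {v} u∈ v∈ u∉G v∉G with G (u ⊕ v) in eq
    ... | true = refl
    ... | false = ⊥-elim (no-three-disjoint 𝟏 (X 𝟏) (λ w → X 𝟏 (w ⊕ u)) (λ w → X 𝟏 (w ⊕ v))
      (λ w p → ∩-elimʳ p)
      (shift-class 𝟏 𝟏 𝟎 refl (==-sound _ 𝟎 u∈))
      (shift-class 𝟏 𝟏 𝟎 refl (==-sound _ 𝟎 v∈))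
      (λ w p r → u∉G (subst (_∈ G) (⊕-cancelˡ w u) (Diff-intro 𝟏 p r)))
      (λ w p r → v∉G (subst (_∈ G) (⊕-cancelˡ w v) (Diff-intro 𝟏 p r)))
      (λ w p r → false≢true eq (subst (_∈ G)
        (⊕-solve (w ∷ u ∷ v ∷ []) ((x₀ ⊞ x₁) ⊞ (x₀ ⊞ x₂)) (x₁ ⊞ x₂) refl) (Diff-intro 𝟏 p r)))
      above₁ (shift-above 𝟏 u above₁) (shift-above 𝟏 v above₁))

    -- Otherwise `X 𝟑`, `X 𝟑` + u and `X 𝟏` + a₂ are pairwise disjoint for u in K outside `G`. The
    -- first and third are disjoint by triangle-freeness; a common point of the last two would put u
    -- into `G`. The final `0v` matches the value of `apply reps` at the all-ones vector.
    a₁+a₂+a₃∉G : ¬ (a₁ ⊕ (a₂ ⊕ (a₃ ⊕ 0v))) ∈ G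
    a₁+a₂+a₃∉G sum∈ with u , u∈ , u∉G ← outside-G = no-three-disjoint 𝟑
      (X 𝟑) (λ w → X 𝟑 (w ⊕ u)) (λ w → X 𝟏 (w ⊕ a₂))
      (λ w p → ∩-elimʳ p)
      (shift-class 𝟑 𝟑 𝟎 refl (==-sound _ 𝟎 u∈))
      (shift-class 𝟏 𝟑 𝟐 refl (class-of 𝟐 a₂∈))
      (λ w p r → u∉G (Diff₃⊆G (subst (_∈ Diff 𝟑) (⊕-cancelˡ w u) (Diff-intro 𝟑 p r))))
      (λ w p r → S-free (w ⊕ a₂) a₂ (∩-elimˡ r) (∩-elimˡ a₂∈) (subst (_∈ S) (sym (⊕-cancelʳ w a₂)) (∩-elimˡ p)))
      (λ w p r → u∉G (subst (_∈ G)
        (⊕-solve (w ∷ u ∷ a₁ ∷ a₂ ∷ a₃ ∷ [])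
          ((((x₀ ⊞ x₁) ⊞ x₄) ⊞ ((x₀ ⊞ x₃) ⊞ x₂)) ⊞ (x₂ ⊞ (x₃ ⊞ (x₄ ⊞ ε)))) x₁ refl)
        (G-closed (G-closed (Diff₃⊆G (Diff-intro 𝟑 p a₃∈)) (Diff-intro 𝟏 r a₁∈)) sum∈)))
      above₃ (shift-above 𝟑 u above₃) (shift-above 𝟏 a₂ above₁)

    0∈G : 0v ∈ G
    0∈G = subst (_∈ G) (⊕-self a₁) (Diff-intro 𝟏 a₁∈ a₁∈)

    g : V n → Bool
    g d = not (G d)

    g-⊕ : ∀ {u v} → u ∈ Class 𝟎 → v ∈ Class 𝟎 → g (u ⊕ v) ≡ g u xor g v
    g-⊕ {u} {v} u∈ v∈ with G u in eqᵤ | G v in eqᵥ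
    ... | true | true = cong not (G-closed eqᵤ eqᵥ)
    ... | false | false = cong not (G-index-2 u∈ v∈ (false≢true eqᵤ) (false≢true eqᵥ))
    ... | true | false = ∁-intro λ p → false≢true eqᵥ (subst (_∈ G) (⊕-cancelˡ u v) (G-closed eqᵤ p))
    ... | false | true = ∁-intro λ p → false≢true eqᵤ (subst (_∈ G) (⊕-cancelʳ u v) (G-closed p eqᵥ))

    -- rep is a section of φ that is not additive; the functional β below takes the value 1 on each aᵢ.
    rep-expr : V 2 → Expr 3
    rep-expr 𝟎 = ε
    rep-expr 𝟏 = x₀
    rep-expr 𝟐 = x₁
    rep-expr 𝟑 = x₂

    nonzero : V 2 → Bool
    nonzero 𝟎 = false
    nonzero 𝟏 = true
    nonzero 𝟐 = true
    nonzero 𝟑 = true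

    reps : Lin 3 n
    reps = a₁ ∷ a₂ ∷ a₃ ∷ []

    rep : V 2 → V n
    rep c = eval reps (rep-expr c)

    φ-rep : ∀ c → (φ $ rep c) ≡ c
    φ-rep 𝟎 = $-0v φ
    φ-rep 𝟏 = class-of 𝟏 a₁∈
    φ-rep 𝟐 = class-of 𝟐 a₂∈
    φ-rep 𝟑 = class-of 𝟑 a₃∈

    -- Measures how far `nonzero` is from additive. The same bit tells whether rep c + rep d + rep
    -- (c + d) is a₁ + a₂ + a₃ or 0, so `g` of that sum recovers it.
    defect : V 2 → V 2 → Bool
    defect c d = (nonzero c xor nonzero d) xor nonzero (c ⊕ d)

    defect-expr : V 2 → V 2 → Expr 3
    defect-expr c d = (rep-expr c ⊞ rep-expr d) ⊞ rep-expr (c ⊕ d)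

    parity-defect : ∀ c d → parity (defect-expr c d) ≡ replicate 3 (defect c d)
    parity-defect 𝟎 𝟎 = refl
    parity-defect 𝟎 𝟏 = refl
    parity-defect 𝟎 𝟐 = refl
    parity-defect 𝟎 𝟑 = refl
    parity-defect 𝟏 𝟎 = refl
    parity-defect 𝟏 𝟏 = refl
    parity-defect 𝟏 𝟐 = refl
    parity-defect 𝟏 𝟑 = refl
    parity-defect 𝟐 𝟎 = refl
    parity-defect 𝟐 𝟏 = refl
    parity-defect 𝟐 𝟐 = refl
    parity-defect 𝟐 𝟑 = refl
    parity-defect 𝟑 𝟎 = refl
    parity-defect 𝟑 𝟏 = refl
    parity-defect 𝟑 𝟐 = refl
    parity-defect 𝟑 𝟑 = refl

    g-defect : ∀ c d → g ((rep c ⊕ rep d) ⊕ rep (c ⊕ d)) ≡ defect c d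
    g-defect c d = trans
      (cong g (trans (eval-parity reps (defect-expr c d)) (cong (apply reps) (parity-defect c d))))
      (value (defect c d))
      where
      value : ∀ b → g (apply reps (replicate 3 b)) ≡ b
      value false = cong not (subst (_∈ G) (sym ($-0v ⟦ reps ⟧)) 0∈G)
      value true = ∁-intro a₁+a₂+a₃∉G

    β : V n → Bool
    β v = g (v ⊕ rep (φ $ v)) xor nonzero (φ $ v)

    v+rep∈Class₀ : ∀ v → (v ⊕ rep (φ $ v)) ∈ Class 𝟎
    v+rep∈Class₀ v = ==-refl _ 𝟎 (trans (class-⊕ _ _ refl (φ-rep (φ $ v))) (⊕-self _))

    -- Neither summand of `β` is additive by itself. Both fail by `defect c d`, for the first one by
    -- `g-defect`, and the two errors cancel.
    β-⊕ : ∀ u v → β (u ⊕ v) ≡ β u xor β v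
    β-⊕ u v = begin
      g ((u ⊕ v) ⊕ rep (φ $ (u ⊕ v))) xor nonzero (φ $ (u ⊕ v))
        ≡⟨ cong (λ z → g ((u ⊕ v) ⊕ rep z) xor nonzero z) (φ .additive u v) ⟩
      g ((u ⊕ v) ⊕ rep (c ⊕ d)) xor nonzero (c ⊕ d)
        ≡⟨ cong (λ z → g z xor nonzero (c ⊕ d)) (⊕-solve (u ∷ v ∷ rep c ∷ rep d ∷ rep (c ⊕ d) ∷ [])
             (x₀ ⊞ x₁ ⊞ x₄) ((x₀ ⊞ x₂) ⊞ (x₁ ⊞ x₃) ⊞ (x₂ ⊞ x₃ ⊞ x₄)) refl) ⟩
      g (((u ⊕ rep c) ⊕ (v ⊕ rep d)) ⊕ δ) xor nonzero (c ⊕ d)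
        ≡⟨ cong (_xor nonzero (c ⊕ d)) (g-⊕ uv∈ δ∈) ⟩
      (g ((u ⊕ rep c) ⊕ (v ⊕ rep d)) xor g δ) xor nonzero (c ⊕ d)
        ≡⟨ cong₂ (λ s t → (s xor t) xor nonzero (c ⊕ d)) (g-⊕ (v+rep∈Class₀ u) (v+rep∈Class₀ v)) (g-defect c d) ⟩
      ((g (u ⊕ rep c) xor g (v ⊕ rep d)) xor defect c d) xor nonzero (c ⊕ d)
        ≡⟨ cancel (g (u ⊕ rep c)) (g (v ⊕ rep d)) (nonzero c) (nonzero d) (nonzero (c ⊕ d)) ⟩
      (g (u ⊕ rep c) xor nonzero c) xor (g (v ⊕ rep d) xor nonzero d) ∎
      where
      open ≡-Reasoning
      c = φ $ u
      d = φ $ v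
      δ = (rep c ⊕ rep d) ⊕ rep (c ⊕ d)
      uv∈ : ((u ⊕ rep c) ⊕ (v ⊕ rep d)) ∈ Class 𝟎
      uv∈ = ==-refl _ 𝟎 (class-⊕ 𝟎 𝟎 (==-sound _ 𝟎 (v+rep∈Class₀ u)) (==-sound _ 𝟎 (v+rep∈Class₀ v)))
      δ∈ : δ ∈ Class 𝟎
      δ∈ = ==-refl _ 𝟎 (trans (class-⊕ _ _ (class-⊕ _ _ (φ-rep c) (φ-rep d)) (φ-rep (c ⊕ d))) (⊕-self _))
      cancel : ∀ s t a b e → ((s xor t) xor ((a xor b) xor e)) xor e ≡ (s xor a) xor (t xor b)
      cancel s t a b e = cong head (⊕-solve ((s ∷ []) ∷ (t ∷ []) ∷ (a ∷ []) ∷ (b ∷ []) ∷ (e ∷ []) ∷ [])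
        ((x₀ ⊞ x₁) ⊞ ((x₂ ⊞ x₃) ⊞ x₄) ⊞ x₄) ((x₀ ⊞ x₂) ⊞ (x₁ ⊞ x₃)) refl)

    affine : Affine S
    affine = hom (λ v → β v ∷ []) (λ u v → cong (_∷ []) (β-⊕ u v)) ,
      λ v v∈S → cong (_∷ []) (value v v∈S (φ $ v) refl)
      where
      differ : ∀ {v} c {a} → v ∈ S → a ∈ X c → (φ $ v) ≡ c → (v ⊕ a) ∈ Diff c
      differ c v∈S a∈ p = Diff-intro c (∩-intro v∈S (==-refl _ c p)) a∈
      value : ∀ v → v ∈ S → ∀ c → (φ $ v) ≡ c → g (v ⊕ rep c) xor nonzero c ≡ true
      -- If `v` in K were in `G`, it would be a difference of two elements of `X 𝟏` and form a
      -- triangle with them.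
      value v v∈S 𝟎 p = trans (𝔹.xor-identityʳ _) (trans (cong g (⊕-identityʳ v)) (∁-intro v∉G))
        where
        v∉G : ¬ v ∈ G
        v∉G v∈G with w , w∈ , w+v∈ ← Diff-elim 𝟏 v∈G = S-free w v (∩-elimˡ w∈) v∈S (∩-elimˡ w+v∈)
      -- In the class of aᵢ, the vector v + aᵢ is in `G`, so `g` contributes 0 and `nonzero`
      -- contributes 1.
      value v v∈S 𝟏 p = cong (λ z → not z xor true) (differ 𝟏 v∈S a₁∈ p)
      value v v∈S 𝟐 p = cong (λ z → not z xor true) (Diff₂⊆G (differ 𝟐 v∈S a₂∈ p))
      value v v∈S 𝟑 p = cong (λ z → not z xor true) (Diff₃⊆G (differ 𝟑 v∈S a₃∈ p))

  #-nonzero-classes : # (S ∩ ∁ (Class 𝟎)) ≤ x 𝟏 + x 𝟐 + x 𝟑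
  #-nonzero-classes = ℕ.≤-trans
    (#-cover (X 𝟏 ∪ X 𝟐) (X 𝟑) (S ∩ ∁ (Class 𝟎)) λ v p →
      split v (∩-elimˡ p) (∁-elim (∩-elimʳ {S v} p)) (φ $ v) refl)
    (ℕ.+-monoˡ-≤ (x 𝟑) (#-cover (X 𝟏) (X 𝟐) (X 𝟏 ∪ X 𝟐) (λ _ → ∪-elim)))
    where
    split : ∀ v → v ∈ S → ¬ v ∈ Class 𝟎 → ∀ c → (φ $ v) ≡ c → (v ∈ X 𝟏 ∪ X 𝟐) ⊎ (v ∈ X 𝟑)
    split v v∈S v∉ 𝟎 p = ⊥-elim (v∉ (==-refl _ 𝟎 p))
    split v v∈S v∉ 𝟏 p = inj₁ (∪-introˡ (∩-intro v∈S (==-refl _ 𝟏 p)))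
    split v v∈S v∉ 𝟐 p = inj₁ (∪-introʳ {X 𝟏 v} (∩-intro v∈S (==-refl _ 𝟐 p)))
    split v v∈S v∉ 𝟑 p = inj₂ (∩-intro v∈S (==-refl _ 𝟑 p))

  dense⇒affine : 7 * q < 5 * # (S ∩ ∁ (Class 𝟎)) → Affine S
  dense⇒affine dense = by-cases (search (X 𝟏)) (search (X 𝟐)) (search (X 𝟑))
    where
    open ℕ.≤-Reasoning
    e : Bool → V 1
    e b = b ∷ []
    dense′ : 7 * q < 5 * (x 𝟏 + x 𝟐 + x 𝟑)
    dense′ = ℕ.<-≤-trans dense (ℕ.*-monoʳ-≤ 5 #-nonzero-classes)
    drop : ∀ c s {t} → (∀ v → ¬ v ∈ X c) → t ≤ s + x c → 7 * q < 5 * t → 7 * q < 5 * s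
    drop c s {t} none t≤ lt = begin-strict
      7 * q          <⟨ lt ⟩
      5 * t          ≤⟨ ℕ.*-monoʳ-≤ 5 t≤ ⟩
      5 * (s + x c)  ≤⟨ ℕ.*-monoʳ-≤ 5 (ℕ.+-monoʳ-≤ s (#-empty (X c) none)) ⟩
      5 * (s + 0)    ≡⟨ cong (5 *_) (ℕ.+-identityʳ s) ⟩
      5 * s          ∎
    rotate : ∀ a b c → a + b + c ≡ (b + c) + a
    rotate = solve-∀
    swap₂₃ : ∀ a b c → (a + b) + c ≡ (a + c) + b
    swap₂₃ = solve-∀
    Search : V 2 → Set
    Search c = (∃ λ v → v ∈ X c) ⊎ (∀ v → ¬ v ∈ X c)
    by-cases : Search 𝟏 → Search 𝟐 → Search 𝟑 → Affine S
    by-cases (inj₁ (a₁ , a₁∈)) (inj₁ (a₂ , a₂∈)) (inj₁ (a₃ , a₃∈)) =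
      All-classes-occupied.affine a₁ a₂ a₃ a₁∈ a₂∈ a₃∈ dense′
    -- In each remaining case the functional is the one on 𝔽₂² whose kernel consists of 𝟎 and the
    -- missed class.
    by-cases (inj₂ none) _ _ = affine-if-class-missed 𝟐 𝟑 𝟏 ⟦ e true ∷ e false ∷ [] ⟧
      (λ { 𝟎 → inj₁ refl ; 𝟏 → inj₂ (inj₁ refl) ; 𝟐 → inj₂ (inj₂ refl) ; 𝟑 → inj₂ (inj₂ refl) })
      (drop 𝟏 (x 𝟐 + x 𝟑) none (ℕ.≤-reflexive (rotate (x 𝟏) (x 𝟐) (x 𝟑))) dense′) none
    by-cases _ (inj₂ none) _ = affine-if-class-missed 𝟏 𝟑 𝟐 ⟦ e false ∷ e true ∷ [] ⟧
      (λ { 𝟎 → inj₁ refl ; 𝟏 → inj₂ (inj₂ refl) ; 𝟐 → inj₂ (inj₁ refl) ; 𝟑 → inj₂ (inj₂ refl) })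
      (drop 𝟐 (x 𝟏 + x 𝟑) none (ℕ.≤-reflexive (swap₂₃ (x 𝟏) (x 𝟐) (x 𝟑))) dense′) none
    by-cases _ _ (inj₂ none) = affine-if-class-missed 𝟏 𝟐 𝟑 ⟦ e true ∷ e true ∷ [] ⟧
      (λ { 𝟎 → inj₁ refl ; 𝟏 → inj₂ (inj₂ refl) ; 𝟐 → inj₂ (inj₂ refl) ; 𝟑 → inj₂ (inj₁ refl) })
      (drop 𝟑 (x 𝟏 + x 𝟐) none ℕ.≤-refl dense′) none

-- Blocking sets

Avoids : Subset n → k ⊸ n → Set
Avoids B T = ∀ v → isZero v ≡ false → B (T $ v) ≡ false

$-nonzero : (f : s ⊸ r) → Inj f → ∀ v → isZero v ≡ false → isZero (f $ v) ≡ false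
$-nonzero {s} f inj v nz with isZero (f $ v) in eq
... | false = refl
... | true with refl ← inj v 0v (trans (isZero-sound _ eq) (sym ($-0v f))) =
  ⊥-elim (false≢true nz (isZero-0v s))

-- A nonzero kernel vector would be sent to 0, which is in `B`. So, for `B` the complement of an
-- edge set, `Avoids` alone already describes an embedded projective geometry.
Avoids⇒Inj : (B : Subset n) → 0v ∈ B → (T : k ⊸ n) → Avoids B T → Inj T
Avoids⇒Inj B 0∈B T avoids = trivial-kernel⇒Inj T kernel
  where
  kernel : ∀ v → (T $ v) ≡ 0v → v ≡ 0v
  kernel v Tv≡0 with isZero v in eq
  ... | true = isZero-sound v eq
  ... | false = ⊥-elim (false≢true (avoids v eq) (subst (_∈ B) (sym Tv≡0) 0∈B))

-- The way in which freeness is exploited: once `T` cannot be extended, `B` must meet every coset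
-- that would extend it.
Avoids-cons : (B : Subset n) (T : k ⊸ n) (x : V n) → Avoids B T →
  (∀ t → ¬ (x ⊕ (T $ t)) ∈ B) → Avoids B (cons x T)
Avoids-cons B T x avoids coset (false ∷ t) nz = trans (cong B (⊕-identityˡ (T $ t))) (avoids t nz)
Avoids-cons B T x avoids coset (true ∷ t) _ = 𝔹.¬-not (coset t)

length-filter-allV : (P : Subset n) → length (filter (λ v → P v 𝔹.≟ true) (allV n)) ≡ # P
length-filter-allV {zero} P with P []
... | true = refl
... | false = refl
length-filter-allV {suc n} P = begin
  length (filter P? (map (false ∷_) (allV n) ++ map (true ∷_) (allV n)))
    ≡⟨ cong length (List.filter-++ P? (map (false ∷_) (allV n)) _) ⟩
  length (filter P? (map (false ∷_) (allV n)) ++ filter P? (map (true ∷_) (allV n)))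
    ≡⟨ List.length-++ (filter P? (map (false ∷_) (allV n))) ⟩
  length (filter P? (map (false ∷_) (allV n))) + length (filter P? (map (true ∷_) (allV n)))
    ≡⟨ cong₂ _+_ (half false) (half true) ⟩
  # P ∎
  where
  open ≡-Reasoning
  P? : ∀ v → Dec (P v ≡ true)
  P? v = P v 𝔹.≟ true
  filter-map : ∀ b vs → length (filter P? (map (b ∷_) vs)) ≡ length (filter (λ v → P? (b ∷ v)) vs)
  filter-map b [] = refl
  filter-map b (v ∷ vs) with P (b ∷ v)
  ... | true = cong suc (filter-map b vs)
  ... | false = filter-map b vs
  half : ∀ b → length (filter P? (map (b ∷_) (allV n))) ≡ # (λ v → P (b ∷ v))
  half b = trans (filter-map b (allV n)) (length-filter-allV (λ v → P (b ∷ v)))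

not-true : ∀ {b} → not b ≡ true → b ≡ false
not-true {false} _ = refl

not-false : ∀ {b} → not b ≡ false → b ≡ true
not-false {true} _ = refl

-- The hypothesis in terms of complements

Codim4-Theorem : Set
Codim4-Theorem = ∀ M′ → (PG[ 4 -1,2] -free) M′ → 13 * 2 ^ rank M′ < 16 * size M′ → χ≡ M′ 3 ⊎ χ≡ M′ 4

module Complement {p} (B : Subset (4 + p)) (0∈B : 0v ∈ B) (small : # B < 3 * 2 ^ p) where

  16u : ∀ u → 2 * (2 * (2 * (2 * u))) ≡ 13 * u + 3 * u
  16u = solve-∀

  large : 13 * 2 ^ p < # (∁ B)
  large = ℕ.+-cancelʳ-< (3 * 2 ^ p) _ _ (begin-strict
    13 * 2 ^ p + 3 * 2 ^ p   ≡⟨ 16u (2 ^ p) ⟨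
    2 ^ (4 + p)              ≡⟨ #-∁ B ⟨
    # B + # (∁ B)            ≡⟨ ℕ.+-comm (# B) _ ⟩
    # (∁ B) + # B            <⟨ ℕ.+-monoʳ-< (# (∁ B)) small ⟩
    # (∁ B) + 3 * 2 ^ p      ∎)
    where open ℕ.≤-Reasoning

  -- The complement of `B` and its translate by `v` each fill over 13/16 of the space, so they meet.
  -- Every vector is thus a sum of two edges, which yields `spanning`.
  two-summands : ∀ v → ∃ λ x → x ∈ ∁ B ∩ (λ x → ∁ B (x ⊕ v))
  two-summands v with search (∁ B ∩ (λ x → ∁ B (x ⊕ v)))
  ... | inj₁ found = found
  ... | inj₂ none = ⊥-elim (ℕ.<⇒≱ (ℕ.+-mono-< large large) (begin
    # (∁ B) + # (∁ B)                      ≡⟨ cong (# (∁ B) +_) (#-translate v (∁ B)) ⟨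
    # (∁ B) + # (λ x → ∁ B (x ⊕ v))
      ≤⟨ #-disjoint (∁ B) (λ x → ∁ B (x ⊕ v)) (λ _ → true) (λ _ _ → refl) (λ _ _ → refl)
                                                (λ x p r → none x (∩-intro p r)) ⟩
    # (λ (_ : V (4 + p)) → true)           ≡⟨ ∑-const (4 + p) 1 ⟩
    2 ^ (4 + p) * 1                        ≡⟨ ℕ.*-identityʳ _ ⟩
    2 ^ (4 + p)                            ≡⟨ 16u (2 ^ p) ⟩
    13 * 2 ^ p + 3 * 2 ^ p                 ≤⟨ ℕ.+-monoʳ-≤ (13 * 2 ^ p) (ℕ.*-monoˡ-≤ (2 ^ p) (ℕ.m≤m+n 3 10)) ⟩
    13 * 2 ^ p + 13 * 2 ^ p                ∎))
    where open ℕ.≤-Reasoning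

  matroid : Matroid
  matroid = record
    { rank = 4 + p
    ; E = ∁ B
    ; no-zero = cong not 0∈B
    ; spanning = λ v → let x , x∈ = two-summands v in
        (x ∷ (x ⊕ v) ∷ []) ,
        (∩-elimˡ x∈ ∷ ∩-elimʳ {∁ B x} x∈ ∷ []) ,
        ⊕-solve (x ∷ v ∷ []) (x₀ ⊞ ((x₀ ⊞ x₁) ⊞ ε)) x₁ refl
    }

  dense : 13 * 2 ^ (4 + p) < 16 * size matroid
  dense = begin-strict
    13 * 2 ^ (4 + p)     ≡⟨ lemma (2 ^ p) ⟩
    16 * (13 * 2 ^ p)    <⟨ ℕ.*-monoʳ-< 16 large ⟩
    16 * # (∁ B)         ≡⟨ cong (16 *_) (length-filter-allV (∁ B)) ⟨
    16 * size matroid    ∎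
    where
    open ℕ.≤-Reasoning
    lemma : ∀ u → 13 * (2 * (2 * (2 * (2 * u)))) ≡ 16 * (13 * u)
    lemma = solve-∀

  blocking : Codim4-Theorem → (∀ (T : 4 ⊸ (4 + p)) → ¬ Avoids B T) →
    Σ (p ⊸ (4 + p)) λ A → Inj A × ∀ v → (A $ v) ∈ B
  blocking theorem₄ no-T = [ codim3 , codim4 ]′ (theorem₄ matroid free dense)
    where
    free : (PG[ 4 -1,2] -free) matroid
    free (ι , _ , ι⊆) = no-T ⟦ ι ⟧ λ v nz → not-true (ι⊆ v (cong not nz))
    codim3 : χ≡ matroid 3 → _
    -- A subspace of codimension 3 has dimension `suc p`; setting its first coordinate to 0 leaves
    -- one of codimension 4.
    codim3 ((_ , A , inj , A⊆) , _) = (⟦ A ⟧ ⊚ 0∷) ,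
      (λ u v eq → ∷-injectiveʳ (inj (false ∷ u) (false ∷ v) eq)) , λ v → not-false (A⊆ (false ∷ v))
    codim4 : χ≡ matroid 4 → _
    codim4 ((_ , A , inj , A⊆) , _) = ⟦ A ⟧ , inj , λ v → not-false (A⊆ v)

-- Averaging over a line spread

-- The 15 points of PG(3,2) are partitioned by the kernels of these five maps (a line spread, from 𝔽₁₆ over 𝔽₄).
spread : List (4 ⊸ 2)
spread =
  ⟦ 𝟐 ∷ 𝟏 ∷ 𝟎 ∷ 𝟎 ∷ [] ⟧ ∷
  ⟦ 𝟎 ∷ 𝟎 ∷ 𝟐 ∷ 𝟏 ∷ [] ⟧ ∷
  ⟦ 𝟐 ∷ 𝟏 ∷ 𝟐 ∷ 𝟏 ∷ [] ⟧ ∷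
  ⟦ 𝟏 ∷ 𝟑 ∷ 𝟐 ∷ 𝟏 ∷ [] ⟧ ∷
  ⟦ 𝟑 ∷ 𝟐 ∷ 𝟐 ∷ 𝟏 ∷ [] ⟧ ∷ []

spread-onto : All Onto spread
spread-onto =
  (λ { 𝟎 → (𝟎 ++ᵛ 𝟎) , refl ; 𝟏 → (𝟏 ++ᵛ 𝟎) , refl ; 𝟐 → (𝟐 ++ᵛ 𝟎) , refl ; 𝟑 → (𝟑 ++ᵛ 𝟎) , refl }) ∷
  onto₂ ∷ onto₂ ∷ onto₂ ∷ onto₂ ∷ []
  where
  onto₂ : ∀ {a b} → Onto ⟦ a ∷ b ∷ 𝟐 ∷ 𝟏 ∷ [] ⟧
  onto₂ {_ ∷ _ ∷ []} {_ ∷ _ ∷ []} 𝟎 = (𝟎 ++ᵛ 𝟎) , refl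
  onto₂ {_ ∷ _ ∷ []} {_ ∷ _ ∷ []} 𝟏 = (𝟎 ++ᵛ 𝟏) , refl
  onto₂ {_ ∷ _ ∷ []} {_ ∷ _ ∷ []} 𝟐 = (𝟎 ++ᵛ 𝟐) , refl
  onto₂ {_ ∷ _ ∷ []} {_ ∷ _ ∷ []} 𝟑 = (𝟎 ++ᵛ 𝟑) , refl

off : n ⊸ k → Subset n
off φ v = not ((φ $ v) == 0v)

-- A nonzero point lies on exactly one of the five lines, hence off the other four.
spread-count : ∀ c → sum (map (λ g → ⟨ off g c ⟩) spread) ≡ 4 * ⟨ not (c == 0v) ⟩
spread-count (false ∷ false ∷ 𝟎) = refl
spread-count (false ∷ false ∷ 𝟏) = refl
spread-count (false ∷ false ∷ 𝟐) = refl
spread-count (false ∷ false ∷ 𝟑) = refl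
spread-count (false ∷ true ∷ 𝟎) = refl
spread-count (false ∷ true ∷ 𝟏) = refl
spread-count (false ∷ true ∷ 𝟐) = refl
spread-count (false ∷ true ∷ 𝟑) = refl
spread-count (true ∷ false ∷ 𝟎) = refl
spread-count (true ∷ false ∷ 𝟏) = refl
spread-count (true ∷ false ∷ 𝟐) = refl
spread-count (true ∷ false ∷ 𝟑) = refl
spread-count (true ∷ true ∷ 𝟎) = refl
spread-count (true ∷ true ∷ 𝟏) = refl
spread-count (true ∷ true ∷ 𝟐) = refl
spread-count (true ∷ true ∷ 𝟑) = refl

∑-spread : (B : Subset n) (f : n ⊸ 4) → (gs : List (4 ⊸ 2)) →
  sum (map (λ g → # (B ∩ off (g ⊚ f))) gs) ≡ ∑ (λ v → sum (map (λ g → ⟨ B v ∧ off g (f $ v) ⟩) gs))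
∑-spread {n} B f [] = sym (trans (∑-const n 0) (ℕ.*-zeroʳ (2 ^ n)))
∑-spread B f (g ∷ gs) =
  trans (cong (# (B ∩ off (g ⊚ f)) +_) (∑-spread B f gs)) (sym (∑-+ (λ v → ⟨ B v ∧ off g (f $ v) ⟩) _))

#-spread : (B : Subset n) (f : n ⊸ 4) →
  sum (map (λ g → # (B ∩ off (g ⊚ f))) spread) ≡ 4 * # (B ∩ off f)
#-spread B f = begin
  sum (map (λ g → # (B ∩ off (g ⊚ f))) spread)                   ≡⟨ ∑-spread B f spread ⟩
  ∑ (λ v → sum (map (λ g → ⟨ B v ∧ off g (f $ v) ⟩) spread))     ≡⟨ ∑-cong pointwise ⟩
  ∑ (λ v → 4 * ⟨ B v ∧ off f v ⟩)                                ≡⟨ ∑-*ˡ 4 (λ v → ⟨ B v ∧ off f v ⟩) ⟩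
  4 * # (B ∩ off f)                                              ∎
  where
  open ≡-Reasoning
  pointwise : ∀ v → sum (map (λ g → ⟨ B v ∧ off g (f $ v) ⟩) spread) ≡ 4 * ⟨ B v ∧ off f v ⟩
  pointwise v with B v
  ... | true = spread-count (f $ v)
  ... | false = refl

≤-sum : ∀ {A : Set} (h : A → ℕ) c (gs : List A) → All (λ g → c ≤ h g) gs → length gs * c ≤ sum (map h gs)
≤-sum h c [] [] = z≤n
≤-sum h c (g ∷ gs) (p ∷ ps) = ℕ.+-mono-≤ p (≤-sum h c gs ps)

sum-*ˡ : ∀ {A : Set} c (h : A → ℕ) gs → sum (map (λ g → c * h g) gs) ≡ c * sum (map h gs)
sum-*ˡ c h [] = sym (ℕ.*-zeroʳ c)
sum-*ˡ c h (g ∷ gs) = trans (cong (c * h g +_) (sum-*ˡ c h gs)) (sym (ℕ.*-distribˡ-+ c (h g) _))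

#-off-spread : (B : Subset n) (f : n ⊸ 4) → Onto f → ∀ c →
  (∀ (φ : n ⊸ 2) → Onto φ → c ≤ 5 * # (B ∩ off φ)) → 5 * c ≤ 20 * # (B ∩ off f)
#-off-spread B f f-onto c all = begin
  5 * c
    ≤⟨ ≤-sum (λ g → 5 * h g) c spread (All.map (λ {g} g-onto → all (g ⊚ f) (onto g g-onto)) spread-onto) ⟩
  sum (map (λ g → 5 * h g) spread)               ≡⟨ sum-*ˡ 5 h spread ⟩
  5 * sum (map h spread)                         ≡⟨ cong (5 *_) (#-spread B f) ⟩
  5 * (4 * # (B ∩ off f))                        ≡⟨ ℕ.*-assoc 5 4 (# (B ∩ off f)) ⟨
  20 * # (B ∩ off f)                             ∎
  where
  open ℕ.≤-Reasoning
  h : 4 ⊸ 2 → ℕ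
  h g = # (B ∩ off (g ⊚ f))
  onto : ∀ (g : 4 ⊸ 2) → Onto g → Onto (g ⊚ f)
  onto g g-onto c with v , refl ← g-onto c with w , refl ← f-onto v = w , refl

-- Rank p + 5: the contradiction

module Minimal-counterexample {p} (theorem₄ : Codim4-Theorem) (B : Subset (5 + p)) (0∈B : 0v ∈ B)
  (small : # B < 3 * 2 ^ p)
  (no-T : ∀ (T : 5 ⊸ (5 + p)) → ¬ Avoids B T)
  (no-A : ∀ (A : p ⊸ (5 + p)) → Inj A → ¬ (∀ v → (A $ v) ∈ B)) where

  u : ℕ
  u = 2 ^ p

  fibre-1 : (ψ : (5 + p) ⊸ 1) → Onto ψ → ∀ c → # (λ v → (ψ $ v) == c) ≡ 16 * u
  fibre-1 ψ onto c = ℕ.*-cancelˡ-≡ _ _ 2 (trans (#-fibre ψ onto c) (lemma u))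
    where
    lemma : ∀ u → 2 * (2 * (2 * (2 * (2 * u)))) ≡ 2 * (16 * u)
    lemma = solve-∀

  -- A subspace of codimension 4 inside B′ is excluded by no-A: its image under j has codimension 5.
  has-T₄ : (j : (4 + p) ⊸ (5 + p)) → Inj j → (B′ : Subset (4 + p)) → 0v ∈ B′ →
    (∀ v → v ∈ B′ → (j $ v) ∈ B) → ¬ (∀ (T : 4 ⊸ (4 + p)) → ¬ Avoids B′ T)
  has-T₄ j j-inj B′ 0∈B′ B′⊆B none = contradict (Complement.blocking B′ 0∈B′ small′ theorem₄ none)
    where
    small′ : # B′ < 3 * 2 ^ p
    small′ = ℕ.≤-<-trans (ℕ.≤-trans (#-mono B′ (λ v → B (j $ v)) B′⊆B) (#-preimage j j-inj B)) small
    contradict : ¬ Σ (p ⊸ (4 + p)) λ A → Inj A × ∀ v → (A $ v) ∈ B′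
    contradict (A , A-inj , A⊆) =
      no-A (j ⊚ A) (λ v w eq → A-inj v w (j-inj _ _ eq)) (λ v → B′⊆B _ (A⊆ v))

  at : (ψ : (5 + p) ⊸ 1) → V 1 → Subset (5 + p)
  at ψ c v = (ψ $ v) == c

  outside-hyperplane : (ψ : (5 + p) ⊸ 1) → Onto ψ → u ≤ # (B ∩ at ψ (true ∷ []))
  -- `has-T₄` is a double negation. The order on ℕ is decidable, so it may be eliminated here.
  outside-hyperplane ψ onto = ℕ.≮⇒≥ λ few →
    has-T₄ ι ι-inj (λ v → B (ι $ v)) (subst (_∈ B) (sym ($-0v ι)) 0∈B) (λ _ p → p)
      λ T avoids → ℕ.<⇒≱ few (many T avoids)
    where
    open Into-kernel (into-kernel ψ)
    many : (T : 4 ⊸ (4 + p)) → Avoids (λ v → B (ι $ v)) T → u ≤ # (B ∩ at ψ (true ∷ []))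
    many T avoids = ℕ.*-cancelˡ-≤ 16 (subst (_≤ 16 * # (B ∩ at ψ (true ∷ []))) (fibre-1 ψ onto (true ∷ []))
      (#-translates (λ t → ι $ T $ t) (B ∩ at ψ (true ∷ [])) (at ψ (true ∷ [])) meets))
      where
      meets : ∀ v → v ∈ at ψ (true ∷ []) → ∃ λ t → (v ⊕ (ι $ T $ t)) ∈ B ∩ at ψ (true ∷ [])
      meets v v∈ with search (λ t → B (v ⊕ (ι $ T $ t)))
      ... | inj₁ (t , p) = t , ∩-intro p (==-refl _ (true ∷ []) (begin
        ψ $ (v ⊕ (ι $ T $ t))        ≡⟨ ψ .additive v _ ⟩
        (ψ $ v) ⊕ (ψ $ ι $ T $ t)    ≡⟨ cong₂ _⊕_ (==-sound _ _ v∈) (ψι≡0 (T $ t)) ⟩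
        true ∷ []                    ∎))
        where open ≡-Reasoning
      ... | inj₂ none = ⊥-elim (no-T (cons v (ι ⊚ T)) (Avoids-cons B (ι ⊚ T) v avoids none))

  -- With H the kernel of `fst ⊚ φ`, the set `B′` is the trace on H of only those points of `B`
  -- where `φ` vanishes. A 4-dimensional subspace of H that avoids `B′` keeps dimension 3 after
  -- imposing `snd ⊚ φ` = 0, and there it avoids all of `B`.
  has-T₃ : (φ : (5 + p) ⊸ 2) →
    ¬ (∀ (T : 3 ⊸ (5 + p)) → (∀ t → (φ $ T $ t) ≡ 𝟎) → ¬ Avoids B T)
  has-T₃ φ none = has-T₄ H.ι H.ι-inj B′ 0∈B′ (λ _ → ∩-elimˡ) no-T₄
    where
    e : Bool → V 1
    e b = b ∷ []
    fst snd : 2 ⊸ 1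
    fst = ⟦ e true ∷ e false ∷ [] ⟧
    snd = ⟦ e false ∷ e true ∷ [] ⟧
    joint-kernel : ∀ c → (fst $ c) ≡ 0v → (snd $ c) ≡ 0v → c ≡ 𝟎
    joint-kernel 𝟎 _ _ = refl
    joint-kernel 𝟏 _ ()
    joint-kernel 𝟐 () _
    joint-kernel 𝟑 () _
    module H = Into-kernel (into-kernel (fst ⊚ φ))
    B′ : Subset (4 + p)
    B′ v = B (H.ι $ v) ∧ (snd $ φ $ H.ι $ v) == 0v
    0∈B′ : 0v ∈ B′
    0∈B′ = ∩-intro (subst (_∈ B) (sym ($-0v H.ι)) 0∈B) (==-refl _ 0v ($-0v (snd ⊚ (φ ⊚ H.ι))))
    no-T₄ : ∀ (T : 4 ⊸ (4 + p)) → ¬ Avoids B′ T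
    no-T₄ T avoids = none (H.ι ⊚ (T ⊚ K.ι)) (λ t → joint-kernel _ (H.ψι≡0 (T $ K.ι $ t)) (K.ψι≡0 t))
      λ t nz → 𝔹.¬-not λ p → false≢true (avoids (K.ι $ t) ($-nonzero K.ι K.ι-inj t nz))
        (∩-intro p (==-refl _ 0v (K.ψι≡0 t)))
      where module K = Into-kernel (into-kernel ((snd ⊚ (φ ⊚ H.ι)) ⊚ T))

  point-off-B : ∃ λ e → e ∈ ∁ B
  point-off-B with search (∁ B)
  ... | inj₁ found = found
  ... | inj₂ none = ⊥-elim (ℕ.<⇒≱ small (begin
    3 * u                ≤⟨ ℕ.*-monoˡ-≤ u (ℕ.m≤m+n 3 29) ⟩
    32 * u               ≡⟨ lemma u ⟩
    2 ^ (5 + p)          ≡⟨ #-∁ B ⟨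
    # B + # (∁ B)        ≤⟨ ℕ.+-monoʳ-≤ (# B) (#-empty (∁ B) none) ⟩
    # B + 0              ≡⟨ ℕ.+-identityʳ _ ⟩
    # B                  ∎))
    where
    open ℕ.≤-Reasoning
    lemma : ∀ u → 32 * u ≡ 2 * (2 * (2 * (2 * (2 * u))))
    lemma = solve-∀

  module Contraction (e : V (5 + p)) (e∉B : B e ≡ false) where

    e-nonzero : isZero e ≡ false
    e-nonzero with isZero e in eq
    ... | false = refl
    ... | true = ⊥-elim (false≢true e∉B (subst (_∈ B) (sym (isZero-sound e eq)) 0∈B))

    ψ : (5 + p) ⊸ 1
    ψ = proj₁ (separating-functional e e-nonzero)

    ψe : (ψ $ e) ≡ true ∷ []
    ψe = proj₂ (separating-functional e e-nonzero)

    open Into-kernel (into-kernel ψ)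

    -- `B/e` is the projection of `B` from `e` onto the hyperplane where `ψ` vanishes, a complement
    -- of `e`; `B₀` and `B₁` come from the two sides of that hyperplane.
    B₀ B₁ B/e : Subset (4 + p)
    B₀ w = B (ι $ w)
    B₁ w = B ((ι $ w) ⊕ e)
    B/e = B₀ ∪ B₁

    #B₀ : # B₀ ≤ # (B ∩ at ψ 0v)
    #B₀ = ℕ.≤-trans
      (#-mono B₀ (λ w → (B ∩ at ψ 0v) (ι $ w)) (λ w p → ∩-intro p (==-refl _ 0v (ψι≡0 w))))
      (#-preimage ι ι-inj (B ∩ at ψ 0v))

    #B₁ : # B₁ ≤ # (B ∩ at ψ (true ∷ []))
    #B₁ = begin
      # B₁
        ≤⟨ #-mono B₁ (λ w → Q ((ι $ w) ⊕ e)) (λ w p → ∩-intro p (==-refl _ _ (ψ=1 w))) ⟩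
      # (λ w → Q ((ι $ w) ⊕ e))      ≤⟨ #-preimage ι ι-inj (λ v → Q (v ⊕ e)) ⟩
      # (λ v → Q (v ⊕ e))            ≡⟨ #-translate e Q ⟩
      # Q                            ∎
      where
      open ℕ.≤-Reasoning
      Q : Subset (5 + p)
      Q = B ∩ at ψ (true ∷ [])
      ψ=1 : ∀ w → (ψ $ ((ι $ w) ⊕ e)) ≡ true ∷ []
      ψ=1 w = trans (ψ .additive _ e) (cong₂ _⊕_ (ψι≡0 w) ψe)

    small′ : # B/e < 3 * 2 ^ p
    small′ = ℕ.≤-<-trans (begin
      # B/e                                              ≤⟨ #-cover B₀ B₁ B/e (λ _ → ∪-elim) ⟩
      # B₀ + # B₁                                        ≤⟨ ℕ.+-mono-≤ #B₀ #B₁ ⟩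
      # (B ∩ at ψ 0v) + # (B ∩ at ψ (true ∷ []))
        ≤⟨ #-disjoint (B ∩ at ψ 0v) (B ∩ at ψ (true ∷ [])) B (λ _ → ∩-elimˡ) (λ _ → ∩-elimˡ) disjoint ⟩
      # B                                                ∎) small
      where
      open ℕ.≤-Reasoning
      disjoint : ∀ v → v ∈ B ∩ at ψ 0v → ¬ v ∈ B ∩ at ψ (true ∷ [])
      disjoint v p r = case trans (sym (==-sound _ 0v (∩-elimʳ {B v} p))) (==-sound _ _ (∩-elimʳ {B v} r)) of λ ()

    0∈B/e : 0v ∈ B/e
    0∈B/e = ∪-introˡ (subst (_∈ B) (sym ($-0v ι)) 0∈B)

    ∉B/e : ∀ {w} → B/e w ≡ false → ¬ w ∈ B₀ × ¬ w ∈ B₁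
    ∉B/e {w} p = (λ q → false≢true p (∪-introˡ q)) , (λ q → false≢true p (∪-introʳ {B₀ w} q))

    -- Adding `e` to a subspace that avoids the projection gives a 5-dimensional one avoiding `B`:
    -- for nonzero t neither the lifted vector nor its sum with `e` is in `B`, and `e` is not
    -- either.
    no-T₄ : ∀ (T : 4 ⊸ (4 + p)) → ¬ Avoids B/e T
    no-T₄ T avoids = no-T (cons e (ι ⊚ T)) (Avoids-cons B (ι ⊚ T) e
      (λ t nz → 𝔹.¬-not (proj₁ (∉B/e (avoids t nz))))
      λ t → coset t (isZero t) refl)
      where
      coset : ∀ t b → isZero t ≡ b → ¬ (e ⊕ (ι $ T $ t)) ∈ B
      coset t false nz p = proj₂ (∉B/e (avoids t nz)) (subst (_∈ B) (⊕-comm e _) p)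
      coset t true z p with refl ← isZero-sound t z =
        false≢true e∉B (subst (_∈ B) (trans (cong (e ⊕_) ($-0v (ι ⊚ T))) (⊕-identityʳ e)) p)

    codim4-in-B/e : Σ (p ⊸ (4 + p)) λ A → Inj A × ∀ v → (A $ v) ∈ B/e
    codim4-in-B/e = Complement.blocking B/e 0∈B/e small′ theorem₄ no-T₄

    A : p ⊸ (4 + p)
    A = proj₁ codim4-in-B/e

    W : suc p ⊸ (5 + p)
    W = cons e (ι ⊚ A)

    W-inj : Inj W
    W-inj = trivial-kernel⇒Inj W kernel
      where
      kernel : ∀ v → (W $ v) ≡ 0v → v ≡ 0v
      kernel (true ∷ v) Wv≡0 = case trans (sym ψW) (trans (cong (ψ $_) Wv≡0) ($-0v ψ)) of λ ()
        where
        ψW : (ψ $ W $ (true ∷ v)) ≡ true ∷ []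
        ψW = trans (ψ .additive e _) (cong₂ _⊕_ ψe (ψι≡0 (A $ v)))
      kernel (false ∷ v) Wv≡0 = cong (false ∷_) (proj₁ (proj₂ codim4-in-B/e) v 0v
        (ι-inj _ _ (trans (sym (⊕-identityˡ _)) (trans Wv≡0 (sym ($-0v (ι ⊚ A)))))))

    u≤#B∘W : u ≤ # (λ v → B (W $ v))
    u≤#B∘W = subst (_≤ # (λ v → B (W $ v))) (trans (∑-const p 1) (ℕ.*-identityʳ u))
      -- The count over `V (suc p)` splits by the first coordinate, the coefficient of `e`. Each w
      -- occurs in one of the halves because `A` maps it into `B/e`.
      (#-cover (λ w → B (W $ (false ∷ w))) (λ w → B (W $ (true ∷ w))) (λ _ → true) λ w _ →
        [ (λ p → inj₁ (subst (_∈ B) (sym (⊕-identityˡ _)) p))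
        , (λ p → inj₂ (subst (_∈ B) (⊕-comm _ e) p)) ]′ (∪-elim (proj₂ (proj₂ codim4-in-B/e) w)))

    annihilator-W : Σ ((5 + p) ⊸ 4) λ f → Onto f × (∀ v → (f $ W $ v) ≡ 0v)
    annihilator-W = annihilator (suc p) 4 (cong suc (ℕ.+-comm p 4)) W

    f : (5 + p) ⊸ 4
    f = proj₁ annihilator-W

    few-off-W : # (B ∩ off f) < 2 * u
    few-off-W = ℕ.+-cancelˡ-< u _ _ (begin-strict
      u + # (B ∩ off f)                ≤⟨ ℕ.+-monoˡ-≤ (# (B ∩ off f)) (ℕ.≤-trans u≤#B∘W on-W) ⟩
      # (B ∩ on) + # (B ∩ off f)       ≤⟨ #-disjoint (B ∩ on) (B ∩ off f) B (λ _ → ∩-elimˡ) (λ _ → ∩-elimˡ)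
                                           (λ v p r → ∁-elim (∩-elimʳ {B v} r) (∩-elimʳ {B v} p)) ⟩
      # B                              <⟨ small ⟩
      u + 2 * u                        ∎)
      where
      open ℕ.≤-Reasoning
      on : Subset (5 + p)
      on v = (f $ v) == 0v
      on-W : # (λ v → B (W $ v)) ≤ # (B ∩ on)
      on-W = ℕ.≤-trans
        (#-mono (λ v → B (W $ v)) (λ v → (B ∩ on) (W $ v)) λ v p →
          ∩-intro p (==-refl _ 0v (proj₂ (proj₂ annihilator-W) v)))
        (#-preimage W W-inj (B ∩ on))

    some-pencil : ¬ (∀ (φ : (5 + p) ⊸ 2) → Onto φ → 8 * u ≤ 5 * # (B ∩ off φ))
    -- With 8u/5 points of `B` off each member of the spread, 5 · 8u ≤ 20 |B ∖ W|, so 2u points of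
    -- `B` would lie off W.
    some-pencil all = ℕ.<⇒≱ few-off-W (ℕ.*-cancelˡ-≤ 20 (subst (_≤ 20 * # (B ∩ off f)) (lemma u)
      (#-off-spread B f (proj₁ (proj₂ annihilator-W)) (8 * u) all)))
      where
      lemma : ∀ u → 5 * (8 * u) ≡ 20 * (2 * u)
      lemma = solve-∀

  module Pencil (φ : (5 + p) ⊸ 2) (φ-onto : Onto φ) (few : 5 * # (B ∩ off φ) < 8 * u)
    (T : 3 ⊸ (5 + p)) (φT : ∀ t → (φ $ T $ t) ≡ 𝟎) (avoids : Avoids B T) where

    S : Subset (5 + p)
    S v = not (any (λ t → B (v ⊕ (T $ t))))

    S-elim : ∀ v → v ∈ S → ∀ t → ¬ (v ⊕ (T $ t)) ∈ B
    S-elim v v∈ t p = ∁-elim v∈ (any-intro (λ t → B (v ⊕ (T $ t))) t p)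

    ∁S-elim : ∀ v → ¬ v ∈ S → ∃ λ t → (v ⊕ (T $ t)) ∈ B
    ∁S-elim v v∉ = any-elim (λ t → B (v ⊕ (T $ t))) (not-false (𝔹.¬-not v∉))

    -- A triangle x, y, x + y in `S` means that the cosets of `T` by these three vectors miss `B`,
    -- so `T` extends by x and y to dimension 5.
    S-free : Triangle-free S
    S-free x y x∈ y∈ x+y∈ = no-T (cons x (cons y T))
      (Avoids-cons B (cons y T) x (Avoids-cons B T y avoids (S-elim y y∈)) λ where
        (false ∷ t) p → S-elim x x∈ t (subst (λ z → (x ⊕ z) ∈ B) (⊕-identityˡ _) p)
        (true ∷ t) p → S-elim (x ⊕ y) x+y∈ t (subst (_∈ B) (sym (⊕-assoc x y _)) p))

    4q≡2ⁿ : 4 * (8 * u) ≡ 2 ^ (5 + p)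
    4q≡2ⁿ = lemma u
      where
      lemma : ∀ u → 4 * (8 * u) ≡ 2 * (2 * (2 * (2 * (2 * u))))
      lemma = solve-∀

    open Classes {q = 8 * u} 4q≡2ⁿ φ φ-onto S S-free using (Class; #-Class; dense⇒affine)

    -- Of the 24u points off K, those outside `S` share a coset of `T` with a point of `B`, still
    -- off K. Hence fewer than 8 · 8u/5 are lost, and 5 · 24u - 64u = 56u = 7q with q = 8u.
    many : 7 * (8 * u) < 5 * # (S ∩ off φ)
    many = ℕ.+-cancelʳ-< (8 * (8 * u)) _ _ (begin-strict
      7 * (8 * u) + 8 * (8 * u)                             ≡⟨ e₁ u ⟩
      5 * (24 * u)                                          ≡⟨ cong (5 *_) #-off ⟨
      5 * # (off φ)
        ≤⟨ ℕ.*-monoʳ-≤ 5 (#-cover (S ∩ off φ) (∁ S ∩ off φ) (off φ) split) ⟩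
      5 * (# (S ∩ off φ) + # (∁ S ∩ off φ))
        ≤⟨ ℕ.*-monoʳ-≤ 5 (ℕ.+-monoʳ-≤ (# (S ∩ off φ)) covered) ⟩
      5 * (# (S ∩ off φ) + 8 * # (B ∩ off φ))               ≡⟨ e₂ (# (S ∩ off φ)) (# (B ∩ off φ)) ⟩
      5 * # (S ∩ off φ) + 8 * (5 * # (B ∩ off φ))
        <⟨ ℕ.+-monoʳ-< (5 * # (S ∩ off φ)) (ℕ.*-monoʳ-< 8 few) ⟩
      5 * # (S ∩ off φ) + 8 * (8 * u)                       ∎)
      where
      open ℕ.≤-Reasoning
      e₁ : ∀ u → 7 * (8 * u) + 8 * (8 * u) ≡ 5 * (24 * u)
      e₁ = solve-∀
      e₂ : ∀ a b → 5 * (a + 8 * b) ≡ 5 * a + 8 * (5 * b)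
      e₂ = solve-∀
      e₃ : ∀ u → 2 * (2 * (2 * (2 * (2 * u)))) ≡ 8 * u + 24 * u
      e₃ = solve-∀
      #-off : # (off φ) ≡ 24 * u
      #-off = ℕ.+-cancelˡ-≡ (8 * u) _ _ (trans (cong (_+ # (off φ)) (sym (#-Class 𝟎)))
        (trans (#-∁ (Class 𝟎)) (e₃ u)))
      split : ∀ v → v ∈ off φ → (v ∈ S ∩ off φ) ⊎ (v ∈ ∁ S ∩ off φ)
      split v v∈ with S v
      ... | true = inj₁ v∈
      ... | false = inj₂ v∈
      covered : # (∁ S ∩ off φ) ≤ 8 * # (B ∩ off φ)
      covered = #-translates (T $_) (B ∩ off φ) (∁ S ∩ off φ) λ v p →
        let t , v+t∈ = ∁S-elim v (∁-elim (∩-elimˡ p)) in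
        t , ∩-intro v+t∈ (subst (λ z → not (z == 𝟎) ≡ true) (sym (φ-shift v t)) (∩-elimʳ {∁ S v} p))
        where
        φ-shift : ∀ v t → (φ $ (v ⊕ (T $ t))) ≡ (φ $ v)
        φ-shift v t = trans (φ .additive v _) (trans (cong ((φ $ v) ⊕_) (φT t)) (⊕-identityʳ _))

    member : ∃ λ s → s ∈ S ∩ off φ
    member = #-positive (S ∩ off φ) (positive (# (S ∩ off φ)) many)
      where
      positive : ∀ {a} b → a < 5 * b → 0 < b
      positive (suc _) _ = s≤s z≤n

    S-shift : ∀ v t → v ∈ S → (v ⊕ (T $ t)) ∈ S
    S-shift v t v∈ = ∁-intro λ p → let t′ , q = any-elim (λ t′ → B ((v ⊕ (T $ t)) ⊕ (T $ t′))) p in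
      S-elim v v∈ (t ⊕ t′)
        (subst (_∈ B) (trans (⊕-assoc v _ _) (cong (v ⊕_) (sym (T .additive t t′)))) q)

    -- Where `ψ` vanishes there is no point of `S`, so `B` meets all cosets of `T` there: 16u/8 = 2u
    -- points. `outside-hyperplane` provides u more.
    not-affine : ¬ Affine S
    not-affine (ψ , S⊆) = ℕ.<⇒≱ small (begin
      3 * u                                            ≡⟨ e₁ u ⟩
      2 * u + u                                        ≤⟨ ℕ.+-mono-≤ inside (outside-hyperplane ψ ψ-onto) ⟩
      # (B ∩ at ψ 0v) + # (B ∩ at ψ (true ∷ []))
        ≤⟨ #-disjoint (B ∩ at ψ 0v) (B ∩ at ψ (true ∷ [])) B (λ _ → ∩-elimˡ) (λ _ → ∩-elimˡ) disjoint ⟩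
      # B                                              ∎)
      where
      open ℕ.≤-Reasoning
      e₁ : ∀ u → 3 * u ≡ 2 * u + u
      e₁ = solve-∀
      e₂ : ∀ u → 8 * (2 * u) ≡ 16 * u
      e₂ = solve-∀
      s₀ : V (5 + p)
      s₀ = proj₁ member
      s₀∈S : s₀ ∈ S
      s₀∈S = ∩-elimˡ (proj₂ member)
      ψ-onto : Onto ψ
      ψ-onto = Onto-functional ψ s₀ (S⊆ s₀ s₀∈S)
      -- `S` is a nonempty union of cosets of `T` on which `ψ` is constantly 1, so `ψ` vanishes on
      -- `T`.
      ψT : ∀ t → (ψ $ T $ t) ≡ 0v
      ψT t = trans (sym (⊕-cancelˡ (ψ $ s₀) _)) (trans (cong ((ψ $ s₀) ⊕_) (sym (ψ .additive s₀ _)))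
        (cong₂ _⊕_ (S⊆ s₀ s₀∈S) (S⊆ (s₀ ⊕ (T $ t)) (S-shift s₀ t s₀∈S))))
      disjoint : ∀ v → v ∈ B ∩ at ψ 0v → ¬ v ∈ B ∩ at ψ (true ∷ [])
      disjoint v p r = case trans (sym (==-sound _ 0v (∩-elimʳ {B v} p))) (==-sound _ _ (∩-elimʳ {B v} r)) of λ ()
      meets : ∀ v → v ∈ at ψ 0v → ∃ λ t → (v ⊕ (T $ t)) ∈ B ∩ at ψ 0v
      meets v v∈ =
        let ψv≡0 = ==-sound _ 0v v∈
            t , v+t∈ = ∁S-elim v (λ v∈S → case trans (sym ψv≡0) (S⊆ v v∈S) of λ ()) in
        t , ∩-intro v+t∈ (==-refl _ 0v (trans (ψ .additive v _) (cong₂ _⊕_ ψv≡0 (ψT t))))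
      inside : 2 * u ≤ # (B ∩ at ψ 0v)
      inside = ℕ.*-cancelˡ-≤ 8 (begin
        8 * (2 * u)              ≡⟨ e₂ u ⟩
        16 * u                   ≡⟨ fibre-1 ψ ψ-onto 0v ⟨
        # (at ψ 0v)              ≤⟨ #-translates (T $_) (B ∩ at ψ 0v) (at ψ 0v) meets ⟩
        8 * # (B ∩ at ψ 0v)      ∎)

    impossible : ⊥
    impossible = not-affine (dense⇒affine many)

  contradiction : ⊥
  contradiction = let e , e∈ = point-off-B in
    Contraction.some-pencil e (not-true e∈) λ φ φ-onto → ℕ.≮⇒≥ λ few →
      has-T₃ φ λ T φT avoids → Pencil.impossible φ φ-onto few T φT avoids

-- Return to matroids

theorem3p4 : (∀ (M' : Matroid) → (PG[ 4 -1,2] -free) M' → 13 * 2 ^ rank M' < 16 * size M' →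
    χ≡ M' 3 ⊎ χ≡ M' 4) →
    ¬ (Σ Matroid λ M → (PG[ 5 -1,2] -free) M × 29 * 2 ^ rank M < 32 * size M ×
    Σ ℕ λ k → χ≡ M k × 5 < k)
theorem3p4 theorem₄ (M , free , dense , k , ((k≤r , _) , minimal) , 5<k) =
  -- A critical number k > 5 excludes codimension 5 by minimality. Also k is at most the rank, so
  -- the rank has the form 5 + p.
  refute M (ℕ.≤-trans (ℕ.<⇒≤ 5<k) k≤r) free dense (minimal 5 5<k)
  where
  refute : ∀ M → 5 ≤ rank M → (PG[ 5 -1,2] -free) M → 29 * 2 ^ rank M < 32 * size M → ¬ ¬ CodimDisjoint M 5
  refute record { rank = suc (suc (suc (suc (suc p)))) ; E = E ; no-zero = no-zero ; spanning = sp }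
    (s≤s (s≤s (s≤s (s≤s (s≤s z≤n))))) free dense no-codim5 =
    Minimal-counterexample.contradiction theorem₄ (∁ E) (cong not no-zero) small
      (λ T avoids → free (matrix T ,
        (λ u v eq → Avoids⇒Inj (∁ E) (cong not no-zero) T avoids u v
          (trans (sym (apply-matrix T u)) (trans eq (apply-matrix T v)))) ,
        λ v nz → trans (cong E (apply-matrix T v)) (not-false (avoids v (not-true nz)))))
      (λ A A-inj A⊆ → no-codim5 (s≤s (s≤s (s≤s (s≤s (s≤s z≤n)))) , matrix A ,
        (λ u v eq → A-inj u v (trans (sym (apply-matrix A u)) (trans eq (apply-matrix A v)))) ,
        λ v → trans (cong E (apply-matrix A v)) (not-true (A⊆ v))))
    where
    open ℕ.≤-Reasoning
    32u : ∀ u → 2 * (2 * (2 * (2 * (2 * u)))) ≡ 29 * u + 3 * u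
    32u = solve-∀
    e₁ : ∀ u → 32 * (29 * u) ≡ 29 * (2 * (2 * (2 * (2 * (2 * u)))))
    e₁ = solve-∀
    many : 29 * 2 ^ p < # E
    many = ℕ.*-cancelˡ-< 32 _ _ (begin-strict
      32 * (29 * 2 ^ p)    ≡⟨ e₁ (2 ^ p) ⟩
      29 * 2 ^ (5 + p)     <⟨ dense ⟩
      32 * length (filter (λ v → E v 𝔹.≟ true) (allV (5 + p)))  ≡⟨ cong (32 *_) (length-filter-allV E) ⟩
      32 * # E             ∎)
    small : # (∁ E) < 3 * 2 ^ p
    small = ℕ.+-cancelˡ-< (29 * 2 ^ p) _ _ (begin-strict
      29 * 2 ^ p + # (∁ E)     <⟨ ℕ.+-monoˡ-< (# (∁ E)) many ⟩
      # E + # (∁ E)            ≡⟨ #-∁ E ⟩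
      2 ^ (5 + p)              ≡⟨ 32u (2 ^ p) ⟩
      29 * 2 ^ p + 3 * 2 ^ p   ∎)
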